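{- Let $p>3$ be prime, $q=p^r$ with $r$ even, and let $E_1,E_2$ be supersingular elliptic curves defined over $\mathbb{F}_q$ with $j(E_1)=j(E_2)=1728$. Then $\#E_1(\mathbb{F}_q)=\#E_2(\mathbb{F}_q)$ if and only if $E_1(\mathbb{F}_q)\cong E_2(\mathbb{F}_q)$ as groups.
   Context: For $E:y^2=x^3+Ax+B$ the $j$-invariant is $j(E)=1728\cdot\frac{4A^3}{4A^3+27B^2}$; $j(E)=1728$ means $E$ has the form $y^2=x^3+ax$. $E$ over $\mathbb{F}_q$ is supersingular if $\#E(\mathbb{F}_q)\equiv 1\pmod p$. $E(\mathbb{F}_q)$ denotes the group of $\mathbb{F}_q$-rational points. -}

module Defs where

open import Level using (0ℓ)
open import Data.Nat as ℕ using (ℕ; zero; suc; _∸_)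
open import Data.Nat.Divisibility using (_∣_)
open import Data.Fin as Fin using (Fin)
open import Data.Fin.Properties as FinP using ()
open import Data.Bool using (Bool; true; false; if_then_else_)
open import Data.Product using (Σ; _,_; proj₁)
open import Relation.Nullary using (¬_; Dec; yes; no; does)
open import Relation.Binary.PropositionalEquality using (_≡_; refl; sym; trans; cong)
open import Algebra.Structures using (IsCommutativeRing)
open import Function.Bundles using (_↔_; Inverse)
open import Data.Unit using (⊤)

record FiniteField (q : ℕ) : Set₁ where
  infixl 6 _+_ _-_
  infixl 7 _*_
  infix 4 _≟_
  field
    Carrier : Set
    _+_ _*_ : Carrier → Carrier → Carrier
    -_      : Carrier → Carrier
    0# 1#   : Carrier
    _⁻¹     : Carrier → Carrier
    isCommutativeRing : IsCommutativeRing _≡_ _+_ _*_ -_ 0# 1#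
    0≢1     : ¬ (0# ≡ 1#)
    *-inverse : ∀ x → ¬ (x ≡ 0#) → x * (x ⁻¹) ≡ 1#
    enum    : Carrier ↔ Fin q

  _-_ : Carrier → Carrier → Carrier
  x - y = x + (- y)

  fromℕ : ℕ → Carrier
  fromℕ zero    = 0#
  fromℕ (suc n) = 1# + fromℕ n

  toFin : Carrier → Fin q
  toFin = Inverse.to enum

  fromFin : Fin q → Carrier
  fromFin = Inverse.from enum

  _≟_ : (x y : Carrier) → Dec (x ≡ y)
  x ≟ y with toFin x FinP.≟ toFin y
  ... | yes e = yes (trans (sym (Inverse.inverseʳ enum refl))
                     (trans (cong fromFin e) (Inverse.inverseʳ enum refl)))
  ... | no ne = no (λ e → ne (cong toFin e))

module _ {q : ℕ} (F : FiniteField q) where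
  open FiniteField F

  record Curve : Set where
    constructor curve
    field
      A B : Carrier
      nonsingular : ¬ (fromℕ 4 * (A * A * A) + fromℕ 27 * (B * B) ≡ 0#)

  jInvariant : Curve → Carrier
  jInvariant (curve A B _) =
    fromℕ 1728 * (fromℕ 4 * (A * A * A))
      * ((fromℕ 4 * (A * A * A) + fromℕ 27 * (B * B)) ⁻¹)

  data RawPoint : Set where
    O   : RawPoint
    aff : Carrier → Carrier → RawPoint

  OnCurve : Curve → RawPoint → Set
  OnCurve E O         = ⊤
  OnCurve E (aff x y) = y * y ≡ x * x * x + Curve.A E * x + Curve.B E

  Point : Curve → Set
  Point E = Σ RawPoint (OnCurve E)

  addPt : Curve → RawPoint → RawPoint → RawPoint
  addPt E O Q = Q
  addPt E P O = P
  addPt E (aff x₁ y₁) (aff x₂ y₂) with does (x₁ ≟ x₂)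
  ... | false =
        let l  = (y₂ - y₁) * ((x₂ - x₁) ⁻¹)
            x₃ = l * l - x₁ - x₂
        in aff x₃ (l * (x₁ - x₃) - y₁)
  ... | true with does (y₁ + y₂ ≟ 0#)
  ...   | true  = O
  ...   | false =
        let l  = (fromℕ 3 * (x₁ * x₁) + Curve.A E) * ((fromℕ 2 * y₁) ⁻¹)
            x₃ = l * l - x₁ - x₂
        in aff x₃ (l * (x₁ - x₃) - y₁)

  sumFin : (n : ℕ) → (Fin n → ℕ) → ℕ
  sumFin zero    f = 0
  sumFin (suc n) f = f Fin.zero ℕ.+ sumFin n (λ i → f (Fin.suc i))

  indicator : Curve → Carrier → Carrier → ℕ
  indicator E x y =
    if does (y * y ≟ x * x * x + Curve.A E * x + Curve.B E) then 1 else 0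

  pointCount : Curve → ℕ
  pointCount E =
    suc (sumFin q (λ i → sumFin q (λ j → indicator E (fromFin i) (fromFin j))))

  Supersingular : ℕ → Curve → Set
  Supersingular p E = p ∣ (pointCount E ∸ 1)

  GroupIso : Curve → Curve → Set
  GroupIso E₁ E₂ =
    Σ (Point E₁ ↔ Point E₂) λ φ →
      ∀ (P Q R : Point E₁) →
        proj₁ R ≡ addPt E₁ (proj₁ P) (proj₁ Q) →
        proj₁ (Inverse.to φ R)
          ≡ addPt E₂ (proj₁ (Inverse.to φ P)) (proj₁ (Inverse.to φ Q))

{-# OPTIONS --safe #-}
module Submission where

-- The condition j = 1728 means B = 0, so write E_a : y² = x³ + a x.  Since r is even, q ≡ 1 mod 4 and
-- -1 is a square.  The substitution x ↦ -x shows that #E_a is 0 or 2 modulo 4 according to whether -a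
-- is a square or not, so equal counts force a₂ = d² a₁.  If d is a square, the curves are isomorphic by
-- (x , y) ↦ (u² x , u³ y).  Otherwise they are quadratic twists, #E₁ + #E₂ = 2q + 2, hence
-- #E₁ = q + 1 ≡ 2 mod 4 and a₁ is not a square.  For p ≡ 1 mod 4 the Hasse invariant of E_a is, up to
-- sign, the binomial coefficient C((q-1)/2 , (q-1)/4) times a power of a; it is nonzero by Lucas, against
-- supersingularity.  For p ≡ 3 mod 4 the Frobenius carries E₁(F_q) onto the points of the curve with
-- coefficient a₁^p, and a₁^p differs from a₂ by a fourth power.

open import Defs
open import Algebra.Bundles using (CommutativeMonoid; CommutativeRing)
import Algebra.Definitions.RawMonoid
import Algebra.Properties.CommutativeMonoid.Sum
import Algebra.Properties.CommutativeSemigroup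
import Algebra.Properties.CommutativeSemiring.Binomial
import Algebra.Properties.CommutativeSemiring.Exp
import Algebra.Properties.Ring
import Algebra.Properties.Semiring.Mult
import Algebra.Properties.Semiring.Sum
import Algebra.Solver.Ring
open import Algebra.Solver.Ring.AlmostCommutativeRing
  using (AlmostCommutativeRing; fromCommutativeRing; _-Raw-AlmostCommutative⟶_)
open import Data.Bool using (if_then_else_)
open import Data.Fin as Fin using (Fin)
import Data.Fin.Permutation as Perm
import Data.Fin.Properties as Finₚ
open import Data.Integer as ℤ using (ℤ; -[1+_]; _⊖_)
import Data.Integer.Properties as ℤₚ
open import Data.Maybe using (Maybe; just; nothing)
open import Data.Nat as ℕ using (ℕ; zero; suc; z≤n; s≤s; _!; _<_; _^_)
open import Data.Nat.Combinatorics
  using (_C_; nCn≡1; nCk≡n!/k![n-k]!; k>n⇒nCk≡0; k![n∸k]!∣n!; nCk+nC[k+1]≡[n+1]C[k+1])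
open import Data.Nat.Coprimality using (Coprime; coprime-Bézout)
open import Data.Nat.DivMod using (_%_; m/n*n≡m; m≡m%n+[m/n]*n; m%n<n; [m+kn]%n≡m%n)
open import Data.Nat.Divisibility using (_∣_; _∣?_; divides; ∣⇒≤; ∣-trans)
open import Data.Nat.GCD using (module Bézout)
open import Data.Nat.Primality using (Prime; prime⇒irreducible; euclidsLemma)
import Data.Nat.Properties as ℕₚ
open import Data.Nat.Solver using (module +-*-Solver)
open import Data.Product using (Σ; ∃; _×_; _,_; proj₁; proj₂)
open import Data.Product.Function.Dependent.Propositional using (Σ-↔)
open import Data.Sum using (_⊎_; inj₁; inj₂; [_,_]′)
open import Data.Sum.Function.Propositional using (_⊎-↔_)
open import Data.Unit using (⊤; tt)
open import Function using (_∘_; id; _↔_; Inverse; mk↔ₛ′; mk⇔)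
open import Function.Bundles using (_⇔_)
open import Function.Construct.Composition using (_↔-∘_)
open import Function.Construct.Identity using (↔-id)
open import Function.Construct.Symmetry using (↔-sym)
open import Relation.Binary.Definitions using (tri<; tri≈; tri>)
open import Relation.Binary.PropositionalEquality hiding (setoid)
open import Relation.Binary.PropositionalEquality.WithK using (≡-irrelevant)
open import Relation.Nullary using (¬_; Dec; yes; no; does; contradiction; ¬?; _×-dec_)
open import Relation.Nullary.Decidable using (dec-true; dec-false; map′)

open Algebra.Definitions.RawMonoid ℕ.+-0-rawMonoid using () renaming (sum to ℕsum)
open Algebra.Properties.CommutativeSemigroup ℕₚ.+-commutativeSemigroup using (interchange)

-- The delicate case is a₂ = d² a₁ with d a nonsquare. There d² is not a fourth power: d² = u⁴ would
-- give d = ± u², and both are squares because -1 is one. So no substitution (u² x , u³ y) over F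
-- carries E₁ to E₂, and an isomorphism of curves over F is out of reach. The group of rational
-- points is a weaker datum than the curve: an automorphism of F also transports it, at the price of
-- moving the coefficient. The nonzero elements modulo fourth powers form a cyclic group of order 4,
-- on which raising to the power p depends only on p mod 4. For p ≡ 3 it is inversion, which swaps
-- the two classes of nonsquares, and these are exactly the classes that differ by the square of a
-- nonsquare. This is why it has to be known that a₁ is a nonsquare. For p ≡ 1 the Frobenius fixes
-- every class and gives nothing new, so that case has to be excluded, which is the work of
-- supersingularity.

-- Finite fields: ring solver, sums and products over the field, roots of polynomials.

module FieldTheory {q : ℕ} (F : FiniteField q) where
  open FiniteField F public

  commutativeRing : CommutativeRing _ _
  commutativeRing = record { isCommutativeRing = isCommutativeRing }

  open CommutativeRing commutativeRing public
    using ( +-assoc; +-comm; +-identityˡ; +-identityʳ; -‿inverseˡ; -‿inverseʳ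
          ; *-assoc; *-comm; *-identityˡ; *-identityʳ; distribˡ; distribʳ
          ; zeroˡ; zeroʳ; +-commutativeMonoid; *-commutativeMonoid
          ; semiring; commutativeSemiring )
  open Algebra.Properties.Ring (CommutativeRing.ring commutativeRing) public
    using (-‿involutive; -‿distribˡ-*; -‿distribʳ-*; -‿+-comm; -0#≈0#; +-cancelˡ)

  fromℕ-+ : ∀ m n → fromℕ (m ℕ.+ n) ≡ fromℕ m + fromℕ n
  fromℕ-+ zero    n = sym (+-identityˡ _)
  fromℕ-+ (suc m) n = trans (cong (1# +_) (fromℕ-+ m n)) (sym (+-assoc _ _ _))

  fromℕ-* : ∀ m n → fromℕ (m ℕ.* n) ≡ fromℕ m * fromℕ n
  fromℕ-* zero    n = sym (zeroˡ _)
  fromℕ-* (suc m) n = begin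
    fromℕ (n ℕ.+ m ℕ.* n)              ≡⟨ fromℕ-+ n (m ℕ.* n) ⟩
    fromℕ n + fromℕ (m ℕ.* n)          ≡⟨ cong₂ _+_ (sym (*-identityˡ _)) (fromℕ-* m n) ⟩
    1# * fromℕ n + fromℕ m * fromℕ n   ≡⟨ distribʳ _ _ _ ⟨
    (1# + fromℕ m) * fromℕ n           ∎
    where open ≡-Reasoning

  -- The image of ℤ serves as the coefficient ring of the ring solver.
  private
    fromℤ : ℤ → Carrier
    fromℤ (ℤ.+ n)    = fromℕ n
    fromℤ -[1+ n ] = - fromℕ (suc n)

    fromℤ-⊖ : ∀ m n → fromℤ (m ⊖ n) ≡ fromℕ m + - fromℕ n
    fromℤ-⊖ m       zero    = sym (trans (cong (fromℕ m +_) -0#≈0#) (+-identityʳ _))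
    fromℤ-⊖ zero    (suc n) = sym (+-identityˡ _)
    fromℤ-⊖ (suc m) (suc n) = begin
      fromℤ (suc m ⊖ suc n)                        ≡⟨ cong fromℤ (ℤₚ.[1+m]⊖[1+n]≡m⊖n m n) ⟩
      fromℤ (m ⊖ n)                                ≡⟨ fromℤ-⊖ m n ⟩
      fromℕ m + - fromℕ n                          ≡⟨ cong (_+ - fromℕ n) (sym (+-identityʳ _)) ⟩
      fromℕ m + 0# + - fromℕ n                     ≡⟨ cong (λ z → fromℕ m + z + - fromℕ n) (sym (-‿inverseʳ 1#)) ⟩
      fromℕ m + (1# + - 1#) + - fromℕ n            ≡⟨ cong (_+ - fromℕ n) (sym (+-assoc _ _ _)) ⟩
      fromℕ m + 1# + - 1# + - fromℕ n              ≡⟨ cong (λ z → z + - 1# + - fromℕ n) (+-comm _ _) ⟩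
      1# + fromℕ m + - 1# + - fromℕ n              ≡⟨ +-assoc _ _ _ ⟩
      1# + fromℕ m + (- 1# + - fromℕ n)            ≡⟨ cong (1# + fromℕ m +_) (-‿+-comm _ _) ⟩
      1# + fromℕ m + - (1# + fromℕ n)              ∎
      where open ≡-Reasoning

    fromℤ-neg : ∀ i → fromℤ (ℤ.- i) ≡ - fromℤ i
    fromℤ-neg (ℤ.+ zero)  = sym -0#≈0#
    fromℤ-neg (ℤ.+ suc n) = refl
    fromℤ-neg -[1+ n ]  = sym (-‿involutive _)

    fromℤ-+ : ∀ i j → fromℤ (i ℤ.+ j) ≡ fromℤ i + fromℤ j
    fromℤ-+ (ℤ.+ m)    (ℤ.+ n)    = fromℕ-+ m n
    fromℤ-+ (ℤ.+ m)    -[1+ n ] = fromℤ-⊖ m (suc n)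
    fromℤ-+ -[1+ m ] (ℤ.+ n)    = trans (fromℤ-⊖ n (suc m)) (+-comm _ _)
    fromℤ-+ -[1+ m ] -[1+ n ] = begin
      - fromℕ (suc (suc (m ℕ.+ n)))          ≡⟨ cong (-_ ∘ fromℕ) (sym (ℕₚ.+-suc (suc m) n)) ⟩
      - fromℕ (suc m ℕ.+ suc n)              ≡⟨ cong -_ (fromℕ-+ (suc m) (suc n)) ⟩
      - (fromℕ (suc m) + fromℕ (suc n))      ≡⟨ -‿+-comm _ _ ⟨
      - fromℕ (suc m) + - fromℕ (suc n)      ∎
      where open ≡-Reasoning

    fromℤ-* : ∀ i j → fromℤ (i ℤ.* j) ≡ fromℤ i * fromℤ j
    fromℤ-* (ℤ.+ m)    (ℤ.+ n)    = trans (cong fromℤ (sym (ℤₚ.pos-* m n))) (fromℕ-* m n)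
    fromℤ-* (ℤ.+ m)    -[1+ n ] = begin
      fromℤ (ℤ.+ m ℤ.* ℤ.- (ℤ.+ suc n))    ≡⟨ cong fromℤ (sym (ℤₚ.neg-distribʳ-* (ℤ.+ m) (ℤ.+ suc n))) ⟩
      fromℤ (ℤ.- (ℤ.+ m ℤ.* ℤ.+ suc n))    ≡⟨ fromℤ-neg (ℤ.+ m ℤ.* ℤ.+ suc n) ⟩
      - fromℤ (ℤ.+ m ℤ.* ℤ.+ suc n)        ≡⟨ cong (-_ ∘ fromℤ) (sym (ℤₚ.pos-* m (suc n))) ⟩
      - fromℕ (m ℕ.* suc n)            ≡⟨ cong -_ (fromℕ-* m (suc n)) ⟩
      - (fromℕ m * fromℕ (suc n))      ≡⟨ -‿distribʳ-* _ _ ⟩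
      fromℕ m * - fromℕ (suc n)        ∎
      where open ≡-Reasoning
    fromℤ-* -[1+ m ] j = begin
      fromℤ (ℤ.- (ℤ.+ suc m) ℤ.* j)      ≡⟨ cong fromℤ (sym (ℤₚ.neg-distribˡ-* (ℤ.+ suc m) j)) ⟩
      fromℤ (ℤ.- (ℤ.+ suc m ℤ.* j))      ≡⟨ fromℤ-neg (ℤ.+ suc m ℤ.* j) ⟩
      - fromℤ (ℤ.+ suc m ℤ.* j)          ≡⟨ cong -_ (fromℤ-*₊ j) ⟩
      - (fromℕ (suc m) * fromℤ j)      ≡⟨ -‿distribˡ-* _ _ ⟩
      - fromℕ (suc m) * fromℤ j        ∎
      where
      open ≡-Reasoning
      fromℤ-*₊ : ∀ j → fromℤ (ℤ.+ suc m ℤ.* j) ≡ fromℕ (suc m) * fromℤ j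
      fromℤ-*₊ (ℤ.+ n)    = fromℤ-* (ℤ.+ suc m) (ℤ.+ n)
      fromℤ-*₊ -[1+ n ] = fromℤ-* (ℤ.+ suc m) -[1+ n ]

    almostCommutativeRing : AlmostCommutativeRing _ _
    almostCommutativeRing = fromCommutativeRing commutativeRing

    homomorphism : ℤ.+-*-rawRing -Raw-AlmostCommutative⟶ almostCommutativeRing
    homomorphism = record
      { ⟦_⟧ = fromℤ ; +-homo = fromℤ-+ ; *-homo = fromℤ-* ; -‿homo = fromℤ-neg
      ; 0-homo = refl ; 1-homo = +-identityʳ 1# }

    _≟ᶜ_ : ∀ i j → Maybe (fromℤ i ≡ fromℤ j)
    i ≟ᶜ j with i ℤ.≟ j
    ... | yes e = just (cong fromℤ e)
    ... | no _  = nothing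

  open Algebra.Solver.Ring ℤ.+-*-rawRing almostCommutativeRing homomorphism _≟ᶜ_ public
    using (solve; _:=_; _:+_; _:*_; _:-_; :-_; con)


  1≢0 : ¬ (1# ≡ 0#)
  1≢0 = 0≢1 ∘ sym

  *-cancelˡ : ∀ {x y z} → ¬ (x ≡ 0#) → x * y ≡ x * z → y ≡ z
  *-cancelˡ {x} {y} {z} x≢0 xy≡xz = begin
    y                  ≡⟨ unscale y ⟨
    x ⁻¹ * (x * y)     ≡⟨ cong (x ⁻¹ *_) xy≡xz ⟩
    x ⁻¹ * (x * z)     ≡⟨ unscale z ⟩
    z                  ∎
    where
    open ≡-Reasoning
    unscale : ∀ w → x ⁻¹ * (x * w) ≡ w
    unscale w = trans (sym (*-assoc _ _ _))
      (trans (cong (_* w) (trans (*-comm _ _) (*-inverse x x≢0))) (*-identityˡ w))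

  integral : ∀ {x y} → x * y ≡ 0# → x ≡ 0# ⊎ y ≡ 0#
  integral {x} {y} xy≡0 with x ≟ 0#
  ... | yes x≡0 = inj₁ x≡0
  ... | no  x≢0 = inj₂ (*-cancelˡ x≢0 (trans xy≡0 (sym (zeroʳ x))))

  *-≢0 : ∀ {x y} → ¬ (x ≡ 0#) → ¬ (y ≡ 0#) → ¬ (x * y ≡ 0#)
  *-≢0 x≢0 y≢0 = [ x≢0 , y≢0 ]′ ∘ integral

  ⁻¹-unique : ∀ {x y} → ¬ (x ≡ 0#) → x * y ≡ 1# → x ⁻¹ ≡ y
  ⁻¹-unique x≢0 xy≡1 = *-cancelˡ x≢0 (trans (*-inverse _ x≢0) (sym xy≡1))

  x-y≡0⇒x≡y : ∀ {x y} → x - y ≡ 0# → x ≡ y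
  x-y≡0⇒x≡y {x} {y} e = begin
    x            ≡⟨ solve 2 (λ x y → x := (x :- y) :+ y) refl x y ⟩
    x - y + y    ≡⟨ cong (_+ y) e ⟩
    0# + y       ≡⟨ +-identityˡ y ⟩
    y            ∎
    where open ≡-Reasoning

  x≡y⇒x-y≡0 : ∀ {x y} → x ≡ y → x - y ≡ 0#
  x≡y⇒x-y≡0 refl = -‿inverseʳ _

  x+y≡0⇒x≡-y : ∀ {x y} → x + y ≡ 0# → x ≡ - y
  x+y≡0⇒x≡-y {x} {y} e = x-y≡0⇒x≡y (trans (cong (x +_) (-‿involutive y)) e)

  x²≡y²⇒x≡±y : ∀ {x y} → x * x ≡ y * y → x ≡ y ⊎ x ≡ - y
  x²≡y²⇒x≡±y {x} {y} e with integral {x - y} {x + y}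
    (trans (solve 2 (λ x y → (x :- y) :* (x :+ y) := x :* x :- y :* y) refl x y) (x≡y⇒x-y≡0 e))
  ... | inj₁ x-y≡0 = inj₁ (x-y≡0⇒x≡y x-y≡0)
  ... | inj₂ x+y≡0 = inj₂ (x+y≡0⇒x≡-y x+y≡0)

  fromFin-toFin : ∀ x → fromFin (toFin x) ≡ x
  fromFin-toFin x = Inverse.inverseʳ enum refl

  toFin-fromFin : ∀ i → toFin (fromFin i) ≡ i
  toFin-fromFin i = Inverse.inverseˡ enum refl

  toFin-injective : ∀ {x y} → toFin x ≡ toFin y → x ≡ y
  toFin-injective {x} {y} e = trans (sym (fromFin-toFin x)) (trans (cong fromFin e) (fromFin-toFin y))

  fromFin-injective : ∀ {i j} → fromFin i ≡ fromFin j → i ≡ j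
  fromFin-injective {i} {j} e = trans (sym (toFin-fromFin i)) (trans (cong toFin e) (toFin-fromFin j))

  -- The monoid is a parameter because three instances occur: sums in the field (`ΣF`), products in
  -- the field (`ΠF`) and counts in ℕ (`#F`).
  module BigSum {c ℓ} (M : CommutativeMonoid c ℓ) where
    open CommutativeMonoid M renaming (Carrier to A; refl to ≈-refl; sym to ≈-sym; trans to ≈-trans)
      using (_≈_; _∙_; ε; setoid; ∙-congˡ; identityʳ)
    open Algebra.Properties.CommutativeMonoid.Sum M
    open import Relation.Binary.Reasoning.Setoid setoid

    ΣF : (Carrier → A) → A
    ΣF f = sum (f ∘ fromFin)

    ΣF-cong : ∀ {f g} → (∀ x → f x ≈ g x) → ΣF f ≈ ΣF g
    ΣF-cong f≈g = sum-cong-≋ (f≈g ∘ fromFin)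

    ΣF-∙ : ∀ f g → ΣF (λ x → f x ∙ g x) ≈ ΣF f ∙ ΣF g
    ΣF-∙ f g = ∑-distrib-+ (f ∘ fromFin) (g ∘ fromFin)

    ΣF-reindex : ∀ f (σ τ : Carrier → Carrier) →
      (∀ x → σ (τ x) ≡ x) → (∀ x → τ (σ x) ≡ x) → ΣF f ≈ ΣF (f ∘ σ)
    ΣF-reindex f σ τ στ τσ = begin
      sum (f ∘ fromFin)                          ≈⟨ sum-permute (f ∘ fromFin) π ⟩
      sum (f ∘ fromFin ∘ toFin ∘ σ ∘ fromFin)    ≡⟨ sum-cong-≗ {q} (λ i → cong f (fromFin-toFin (σ (fromFin i)))) ⟩
      sum (f ∘ σ ∘ fromFin)                      ∎
      where
      conj : (Carrier → Carrier) → Fin q → Fin q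
      conj ρ = toFin ∘ ρ ∘ fromFin
      conj-inverse : ∀ ρ ρ′ → (∀ x → ρ (ρ′ x) ≡ x) → ∀ i → conj ρ (conj ρ′ i) ≡ i
      conj-inverse ρ ρ′ e i = trans (cong (toFin ∘ ρ) (fromFin-toFin _))
        (trans (cong toFin (e _)) (toFin-fromFin i))
      π : Perm.Permutation q q
      π = mk↔ₛ′ (conj σ) (conj τ) (conj-inverse σ τ στ) (conj-inverse τ σ τσ)

    ΣF-scale : ∀ f {a} → ¬ (a ≡ 0#) → ΣF f ≈ ΣF (f ∘ (a *_))
    ΣF-scale f {a} a≢0 = ΣF-reindex f (a *_) (a ⁻¹ *_)
      (λ x → trans (sym (*-assoc _ _ _)) (trans (cong (_* x) (*-inverse a a≢0)) (*-identityˡ x)))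
      (λ x → trans (sym (*-assoc _ _ _)) (trans (cong (_* x) (trans (*-comm _ _) (*-inverse a a≢0))) (*-identityˡ x)))

    sum-single : ∀ {n} (f : Fin n → A) i → (∀ j → ¬ (j ≡ i) → f j ≈ ε) → sum f ≈ f i
    sum-single {suc n} f i vanish = begin
      sum f                              ≈⟨ sum-remove f ⟩
      f i ∙ sum (f ∘ Fin.punchIn i)      ≈⟨ ∙-congˡ (sum-cong-≋ (λ j → vanish _ (Finₚ.punchInᵢ≢i i j))) ⟩
      f i ∙ sum {n} (λ _ → ε)            ≈⟨ ∙-congˡ (sum-replicate-zero n) ⟩
      f i ∙ ε                            ≈⟨ identityʳ (f i) ⟩
      f i                                ∎

    ΣF-single : ∀ f a → (∀ x → ¬ (x ≡ a) → f x ≈ ε) → ΣF f ≈ f a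
    ΣF-single f a vanish = begin
      ΣF f                  ≈⟨ sum-single (f ∘ fromFin) (toFin a)
                                 (λ j j≢a → vanish _ (λ e → j≢a (trans (sym (toFin-fromFin j)) (cong toFin e)))) ⟩
      f (fromFin (toFin a)) ≡⟨ cong f (fromFin-toFin a) ⟩
      f a                   ∎

  open BigSum +-commutativeMonoid public
  open BigSum *-commutativeMonoid public using ()
    renaming (ΣF to ΠF; ΣF-cong to ΠF-cong; ΣF-∙ to ΠF-*; ΣF-scale to ΠF-scale; ΣF-single to ΠF-single)
  open BigSum ℕₚ.+-0-commutativeMonoid public using ()
    renaming (ΣF to #F; ΣF-cong to #F-cong; ΣF-∙ to #F-+; ΣF-reindex to #F-reindex; ΣF-scale to #F-scale; ΣF-single to #F-single)
  open Algebra.Properties.CommutativeSemiring.Exp commutativeSemiring public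
    using (^-homo-*; ^-assocʳ; ^-distrib-*) renaming (_^_ to infixr 8 _^ᶠ_)
  open Algebra.Properties.Semiring.Sum semiring public using (sum; sum-replicate; ∑-comm; *-distribˡ-sum; sum-cong-≗)
  open Algebra.Properties.Semiring.Mult semiring public using () renaming (_×_ to infixr 8 _·_)

  fromℕ≡×1 : ∀ n → n · 1# ≡ fromℕ n
  fromℕ≡×1 zero    = refl
  fromℕ≡×1 (suc n) = cong (1# +_) (fromℕ≡×1 n)

  ·≡fromℕ* : ∀ k x → k · x ≡ fromℕ k * x
  ·≡fromℕ* zero    x = sym (zeroˡ x)
  ·≡fromℕ* (suc k) x = trans (cong₂ _+_ (sym (*-identityˡ x)) (·≡fromℕ* k x)) (sym (distribʳ x 1# (fromℕ k)))

  1^ : ∀ n → 1# ^ᶠ n ≡ 1#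
  1^ zero    = refl
  1^ (suc n) = trans (*-identityˡ _) (1^ n)

  ^-≢0 : ∀ {x} n → ¬ (x ≡ 0#) → ¬ (x ^ᶠ n ≡ 0#)
  ^-≢0 zero    x≢0 = 1≢0
  ^-≢0 (suc n) x≢0 = *-≢0 x≢0 (^-≢0 n x≢0)

  fromℕ-^ : ∀ m n → fromℕ (m ℕ.^ n) ≡ fromℕ m ^ᶠ n
  fromℕ-^ m zero    = +-identityʳ 1#
  fromℕ-^ m (suc n) = trans (fromℕ-* m (m ℕ.^ n)) (cong (fromℕ m *_) (fromℕ-^ m n))

  fromℕ-sum : ∀ {n} (f : Fin n → ℕ) → fromℕ (ℕsum f) ≡ sum (fromℕ ∘ f)
  fromℕ-sum {zero}  f = refl
  fromℕ-sum {suc n} f = trans (fromℕ-+ (f Fin.zero) _) (cong (fromℕ (f Fin.zero) +_) (fromℕ-sum (f ∘ Fin.suc)))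

  ΣF-1 : ΣF (λ _ → 1#) ≡ fromℕ q
  ΣF-1 = trans (sum-replicate q) (fromℕ≡×1 q)

  -- The translation x ↦ x + 1 permutes the field, so the sum of all elements equals itself plus q
  -- times 1.
  fromℕ-order : fromℕ q ≡ 0#
  fromℕ-order = +-cancelˡ (ΣF id) _ _ (begin
    ΣF id + fromℕ q             ≡⟨ cong (ΣF id +_) ΣF-1 ⟨
    ΣF id + ΣF (λ _ → 1#)       ≡⟨ ΣF-∙ id (λ _ → 1#) ⟨
    ΣF (λ x → x + 1#)           ≡⟨ ΣF-reindex id (_+ 1#) (_- 1#)
                                     (λ x → solve 2 (λ x y → (x :- y) :+ y := x) refl x 1#)
                                     (λ x → solve 2 (λ x y → (x :+ y) :- y := x) refl x 1#) ⟨
    ΣF id                       ≡⟨ +-identityʳ _ ⟨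
    ΣF id + 0#                  ∎)
    where open ≡-Reasoning

  ΠF-≢0 : ∀ f → (∀ x → ¬ (f x ≡ 0#)) → ¬ (ΠF f ≡ 0#)
  ΠF-≢0 f f≢0 = product-≢0 (f≢0 ∘ fromFin)
    where
    product-≢0 : ∀ {n} {g : Fin n → Carrier} → (∀ i → ¬ (g i ≡ 0#)) →
      ¬ (Algebra.Properties.CommutativeMonoid.Sum.sum *-commutativeMonoid g ≡ 0#)
    product-≢0 {zero}  g≢0 = 1≢0
    product-≢0 {suc n} g≢0 = *-≢0 (g≢0 Fin.zero) (product-≢0 (g≢0 ∘ Fin.suc))

  -- Multiplication by a permutes the nonzero elements, so it preserves their product.
  fermat : ∀ {a} → ¬ (a ≡ 0#) → a ^ᶠ q ≡ a
  fermat {a} a≢0 = begin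
    a ^ᶠ q                          ≡⟨ Algebra.Properties.CommutativeMonoid.Sum.sum-replicate *-commutativeMonoid q ⟨
    ΠF (λ _ → a)                   ≡⟨ ΠF-cong at-zero-or-not ⟩
    ΠF (λ x → k x * z x)           ≡⟨ ΠF-* k z ⟩
    ΠF k * ΠF z                    ≡⟨ cong₂ _*_ Πk≡1 Πz≡a ⟩
    1# * a                         ≡⟨ *-identityˡ a ⟩
    a                              ∎
    where
    open ≡-Reasoning
    g k z : Carrier → Carrier
    -- `g` replaces the factor 0 by 1, so that its product over the whole field is the product of
    -- the units. The q constant factors a are split into those at the units (`k`) and the single
    -- one at 0 (`z`). The latter is why the exponent is q and the result a, instead of q - 1 and 1.
    g x = if does (x ≟ 0#) then 1# else x
    k x = if does (x ≟ 0#) then 1# else a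
    z x = if does (x ≟ 0#) then a else 1#

    at-zero-or-not : ∀ x → a ≡ k x * z x
    at-zero-or-not x with x ≟ 0#
    ... | yes _ = sym (*-identityˡ a)
    ... | no _  = sym (*-identityʳ a)

    Πz≡a : ΠF z ≡ a
    Πz≡a = trans (ΠF-single z 0# off-zero) at-zero
      where
      off-zero : ∀ x → ¬ (x ≡ 0#) → z x ≡ 1#
      off-zero x x≢0 with x ≟ 0#
      ... | yes x≡0 = contradiction x≡0 x≢0
      ... | no _    = refl
      at-zero : z 0# ≡ a
      at-zero with 0# ≟ 0#
      ... | yes _  = refl
      ... | no 0≢0 = contradiction refl 0≢0

    g≢0 : ∀ x → ¬ (g x ≡ 0#)
    g≢0 x with x ≟ 0#
    ... | yes _  = 1≢0
    ... | no x≢0 = x≢0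

    g-scale : ∀ x → g (a * x) ≡ k x * g x
    g-scale x with x ≟ 0# | a * x ≟ 0#
    ... | yes _   | yes _    = sym (*-identityˡ 1#)
    ... | yes x≡0 | no ax≢0  = contradiction (trans (cong (a *_) x≡0) (zeroʳ a)) ax≢0
    ... | no x≢0  | yes ax≡0 = contradiction ax≡0 (*-≢0 a≢0 x≢0)
    ... | no _    | no _     = refl

    Πk≡1 : ΠF k ≡ 1#
    Πk≡1 = *-cancelˡ (ΠF-≢0 g g≢0) (begin
      ΠF g * ΠF k               ≡⟨ *-comm _ _ ⟩
      ΠF k * ΠF g               ≡⟨ ΠF-* k g ⟨
      ΠF (λ x → k x * g x)      ≡⟨ ΠF-cong g-scale ⟨
      ΠF (λ x → g (a * x))      ≡⟨ ΠF-scale g a≢0 ⟨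
      ΠF g                      ≡⟨ *-identityʳ _ ⟨
      ΠF g * 1#                 ∎)

  -- f is a polynomial function of degree less than n, expressed through divided differences.
  Poly : ℕ → (Carrier → Carrier) → Set
  Poly zero    f = ∀ x → f x ≡ 0#
  Poly (suc n) f = ∀ r → Σ (Carrier → Carrier) λ g → Poly n g × (∀ x → f x ≡ f r + (x - r) * g x)

  -- If g is the divided difference of f at r, then that of x f(x) is f(r) + x g(x), again a Horner
  -- step of one degree less.
  Poly-horner : ∀ n {f} c → Poly n f → Poly (suc n) (λ x → c + x * f x)
  Poly-horner zero {f} c f≡0 r = (λ _ → 0#) , (λ _ → refl) , λ x → begin
    c + x * f x                        ≡⟨ cong (λ u → c + x * u) (f≡0 x) ⟩
    c + x * 0#                         ≡⟨ solve 3 (λ c x r → c :+ x :* con (ℤ.+ 0) := c :+ r :* con (ℤ.+ 0) :+ (x :- r) :* con (ℤ.+ 0)) refl c x r ⟩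
    c + r * 0# + (x - r) * 0#          ≡⟨ cong (λ u → c + r * u + (x - r) * 0#) (f≡0 r) ⟨
    c + r * f r + (x - r) * 0#         ∎
    where open ≡-Reasoning
  Poly-horner (suc n) {f} c Pf r with Pf r
  ... | g , Pg , f≡ = (λ x → f r + x * g x) , Poly-horner n (f r) Pg , λ x → begin
    c + x * f x                                      ≡⟨ cong (λ u → c + x * u) (f≡ x) ⟩
    c + x * (f r + (x - r) * g x)                    ≡⟨ solve 5 (λ c x r fr gx → c :+ x :* (fr :+ (x :- r) :* gx)
                                                          := (c :+ r :* fr) :+ (x :- r) :* (fr :+ x :* gx)) refl c x r (f r) (g x) ⟩
    c + r * f r + (x - r) * (f r + x * g x)          ∎
    where open ≡-Reasoning

  -- The divided difference at the first root is a cofactor of smaller degree. Injectivity of ρ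
  -- keeps x - r away from zero at the other roots, so they pass to the cofactor.
  Poly-roots : ∀ n {f} → Poly n f → (ρ : Fin n → Carrier) → (∀ {i j} → ρ i ≡ ρ j → i ≡ j) →
    (∀ i → f (ρ i) ≡ 0#) → ∀ x → f x ≡ 0#
  Poly-roots zero    Pf ρ ρ-inj roots x = Pf x
  Poly-roots (suc n) {f} Pf ρ ρ-inj roots x with Pf (ρ Fin.zero)
  ... | g , Pg , f≡ = begin
    f x                                  ≡⟨ f≡ x ⟩
    f r + (x - r) * g x                  ≡⟨ cong₂ (λ u v → u + (x - r) * v) (roots Fin.zero) (g≡0 x) ⟩
    0# + (x - r) * 0#                    ≡⟨ trans (+-identityˡ _) (zeroʳ _) ⟩
    0#                                   ∎
    where
    open ≡-Reasoning
    r = ρ Fin.zero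
    g-roots : ∀ i → g (ρ (Fin.suc i)) ≡ 0#
    g-roots i with integral {ρ (Fin.suc i) - r} (begin
      (ρ (Fin.suc i) - r) * g (ρ (Fin.suc i))           ≡⟨ +-identityˡ _ ⟨
      0# + (ρ (Fin.suc i) - r) * g (ρ (Fin.suc i))      ≡⟨ cong (_+ (ρ (Fin.suc i) - r) * g (ρ (Fin.suc i))) (roots Fin.zero) ⟨
      f r + (ρ (Fin.suc i) - r) * g (ρ (Fin.suc i))     ≡⟨ f≡ _ ⟨
      f (ρ (Fin.suc i))                                 ≡⟨ roots (Fin.suc i) ⟩
      0#                                                ∎)
    ... | inj₂ e = e
    ... | inj₁ e with ρ-inj (x-y≡0⇒x≡y e)
    ...   | ()
    g≡0 = Poly-roots n Pg (ρ ∘ Fin.suc) (Finₚ.suc-injective ∘ ρ-inj) g-roots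

  Poly-resp : ∀ n {f g} → (∀ x → f x ≡ g x) → Poly n f → Poly n g
  Poly-resp zero    f≡g Pf x = trans (sym (f≡g x)) (Pf x)
  Poly-resp (suc n) f≡g Pf r =
    let h , Ph , f≡ = Pf r
    in h , Ph , λ x → trans (sym (f≡g x)) (trans (f≡ x) (cong (_+ (x - r) * h x) (f≡g r)))

  Poly-^ : ∀ n → Poly (suc n) (_^ᶠ n)
  Poly-^ zero    = Poly-resp 1 (λ x → trans (cong (1# +_) (zeroʳ x)) (+-identityʳ 1#))
                     (Poly-horner 0 {λ _ → 0#} 1# (λ _ → refl))
  Poly-^ (suc n) = Poly-resp (suc (suc n)) (λ x → +-identityˡ _) (Poly-horner (suc n) 0# (Poly-^ n))

-- Indicators and bounded finite sums.

-- It has the same `if does` shape as `indicator`, so the two agree by definition.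
𝟙 : ∀ {p} {P : Set p} → Dec P → ℕ
𝟙 d = if does d then 1 else 0

𝟙-yes : ∀ {p} {P : Set p} (d : Dec P) → P → 𝟙 d ≡ 1
𝟙-yes (yes _) _  = refl
𝟙-yes (no ¬p) p = contradiction p ¬p

𝟙-no : ∀ {p} {P : Set p} (d : Dec P) → ¬ P → 𝟙 d ≡ 0
𝟙-no (yes p) ¬p = contradiction p ¬p
𝟙-no (no _)  _  = refl

𝟙-cong : ∀ {p r} {P : Set p} {R : Set r} (d : Dec P) (e : Dec R) → (P → R) → (R → P) → 𝟙 d ≡ 𝟙 e
𝟙-cong (yes p) e f g = sym (𝟙-yes e (f p))
𝟙-cong (no ¬p) e f g = sym (𝟙-no e (¬p ∘ g))

sum-replicate-ℕ : ∀ n k → ℕsum {n} (λ _ → k) ≡ n ℕ.* k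
sum-replicate-ℕ zero    k = refl
sum-replicate-ℕ (suc n) k = cong (k ℕ.+_) (sum-replicate-ℕ n k)

sum-bounded : ∀ {n k} (f : Fin n → ℕ) → (∀ i → f i ℕ.≤ k) → ℕsum f ℕ.≤ n ℕ.* k
sum-bounded {zero}  f f≤k = z≤n
sum-bounded {suc n} f f≤k = ℕₚ.+-mono-≤ (f≤k Fin.zero) (sum-bounded (f ∘ Fin.suc) (f≤k ∘ Fin.suc))

-- The tail can use up at most n k, which leaves at least k for the first term. In `N-twist` this
-- turns a global count into a pointwise identity.
sum-saturated : ∀ {n k} (f : Fin n → ℕ) → (∀ i → f i ℕ.≤ k) → ℕsum f ≡ n ℕ.* k → ∀ i → f i ≡ k
sum-saturated {suc n} {k} f f≤k Σf≡ = λ where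
    Fin.zero    → f₀≡k
    (Fin.suc i) → sum-saturated (f ∘ Fin.suc) (f≤k ∘ Fin.suc)
                    (ℕₚ.+-cancelˡ-≡ (f Fin.zero) _ _ (trans Σf≡ (cong (ℕ._+ n ℕ.* k) (sym f₀≡k)))) i
  where
  f₀≡k : f Fin.zero ≡ k
  f₀≡k = ℕₚ.≤-antisym (f≤k Fin.zero) (ℕₚ.+-cancelʳ-≤ (n ℕ.* k) k (f Fin.zero)
    (subst (ℕ._≤ f Fin.zero ℕ.+ n ℕ.* k) Σf≡
      (ℕₚ.+-monoʳ-≤ (f Fin.zero) (sum-bounded (f ∘ Fin.suc) (f≤k ∘ Fin.suc)))))

cast-injective : ∀ {a b} .(e : a ≡ b) {i j : Fin a} → Fin.cast e i ≡ Fin.cast e j → i ≡ j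
cast-injective e {i} {j} eq = Finₚ.toℕ-injective
  (trans (sym (Finₚ.toℕ-cast e i)) (trans (cong Fin.toℕ eq) (Finₚ.toℕ-cast e j)))

-- Squares, nonsquares and Euler's criterion for q = 4n + 1.

module QuadraticTheory {q : ℕ} (F : FiniteField q) (n : ℕ)
  (order : q ≡ suc ((n ℕ.+ n) ℕ.+ (n ℕ.+ n))) where

  open FieldTheory F public

  -- This is (q - 1)/2, the exponent in Euler's criterion; correspondingly `n` is (q - 1)/4 and m +
  -- m is q - 1.
  m : ℕ
  m = n ℕ.+ n

  n≢0 : ¬ (n ≡ 0)
  n≢0 n≡0 = 0≢1 (toFin-injective (cast-injective q≡1 (single (Fin.cast q≡1 (toFin 0#)) (Fin.cast q≡1 (toFin 1#)))))
    where
    q≡1 : q ≡ 1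
    q≡1 = trans order (cong (λ k → suc ((k ℕ.+ k) ℕ.+ (k ℕ.+ k))) n≡0)
    single : (i j : Fin 1) → i ≡ j
    single Fin.zero Fin.zero = refl

  0<m : 0 ℕ.< m
  0<m = ℕₚ.<-≤-trans (ℕₚ.n≢0⇒n>0 n≢0) (ℕₚ.m≤m+n n n)

  -- q = 2m + 1 vanishes in the field; if 2 vanished as well, so would 1.
  2≢0 : ¬ (1# + 1# ≡ 0#)
  2≢0 1+1≡0 = 1≢0 (begin
    1#                                   ≡⟨ +-identityʳ 1# ⟨
    1# + 0#                              ≡⟨ cong (1# +_) (zeroˡ _) ⟨
    1# + 0# * fromℕ m                    ≡⟨ cong (λ z → 1# + z * fromℕ m) 1+1≡0 ⟨
    1# + (1# + 1#) * fromℕ m             ≡⟨ cong (1# +_) (distribʳ _ _ _) ⟩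
    1# + (1# * fromℕ m + 1# * fromℕ m)   ≡⟨ cong (1# +_) (cong₂ _+_ (*-identityˡ _) (*-identityˡ _)) ⟩
    1# + (fromℕ m + fromℕ m)             ≡⟨ cong (1# +_) (fromℕ-+ m m) ⟨
    fromℕ (suc (m ℕ.+ m))                ≡⟨ cong fromℕ order ⟨
    fromℕ q                              ≡⟨ fromℕ-order ⟩
    0#                                   ∎)
    where open ≡-Reasoning

  x+x≢0 : ∀ {x} → ¬ (x ≡ 0#) → ¬ (x + x ≡ 0#)
  x+x≢0 {x} x≢0 x+x≡0 = *-≢0 2≢0 x≢0
    (trans (distribʳ x 1# 1#) (trans (cong₂ _+_ (*-identityˡ x) (*-identityˡ x)) x+x≡0))

  x≢-x : ∀ {x} → ¬ (x ≡ 0#) → ¬ (x ≡ - x)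
  x≢-x {x} x≢0 x≡-x = x+x≢0 x≢0 (trans (cong (x +_) x≡-x) (-‿inverseʳ x))

  little-fermat : ∀ {x} → ¬ (x ≡ 0#) → x ^ᶠ (m ℕ.+ m) ≡ 1#
  little-fermat {x} x≢0 = *-cancelˡ x≢0
    (trans (cong (x ^ᶠ_) (sym order)) (trans (fermat x≢0) (sym (*-identityʳ x))))

  units : Fin (m ℕ.+ m) → Carrier
  units i = fromFin (Fin.cast (sym order) (Fin.punchIn (Fin.cast order (toFin 0#)) i))

  units-injective : ∀ {i j} → units i ≡ units j → i ≡ j
  units-injective {i} {j} e =
    Finₚ.punchIn-injective _ i j (cast-injective (sym order) (fromFin-injective e))

  units-≢0 : ∀ i → ¬ (units i ≡ 0#)
  units-≢0 i e = Finₚ.punchInᵢ≢i (Fin.cast order (toFin 0#)) i (cast-injective (sym order)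
    (trans (trans (sym (toFin-fromFin _)) (cong toFin e))
      (sym (trans (Finₚ.cast-trans order (sym order) (toFin 0#)) (Finₚ.cast-is-id refl (toFin 0#))))))

  -- A stand-in for a primitive root. There are at least j + 1 distinct units; if all of them were
  -- roots of x^j - 1, which has degree j, this polynomial would vanish identically, also at 0,
  -- where its value is -1.
  power-nontrivial : ∀ j → 0 ℕ.< j → j ℕ.< m ℕ.+ m → ∃ λ g → ¬ (g ≡ 0#) × ¬ (g ^ᶠ j ≡ 1#)
  power-nontrivial (suc j) _ j<2m =
    let i , g^j≢1 = Finₚ.¬∀⟶∃¬ (suc (suc j)) (λ i → ρ i ^ᶠ suc j ≡ 1#) (λ i → ρ i ^ᶠ suc j ≟ 1#) not-all
    in ρ i , units-≢0 _ , g^j≢1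
    where
    ρ : Fin (suc (suc j)) → Carrier
    ρ i = units (Fin.inject≤ i j<2m)
    not-all : ¬ (∀ i → ρ i ^ᶠ suc j ≡ 1#)
    not-all all-1 = 1≢0 (begin
      1#                             ≡⟨ -‿involutive 1# ⟨
      - - 1#                         ≡⟨ cong -_ (+-identityʳ _) ⟨
      - (- 1# + 0#)                  ≡⟨ cong (λ z → - (- 1# + z)) (zeroˡ _) ⟨
      - (- 1# + 0# * 0# ^ᶠ j)         ≡⟨ cong -_ (Poly-roots (suc (suc j)) (Poly-horner (suc j) (- 1#) (Poly-^ j)) ρ
                                          (Finₚ.inject≤-injective j<2m j<2m _ _ ∘ units-injective)
                                          (λ i → trans (cong (- 1# +_) (all-1 i)) (-‿inverseˡ 1#)) 0#) ⟩
      - 0#                           ≡⟨ -0#≈0# ⟩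
      0#                             ∎)
      where open ≡-Reasoning

  Square : Carrier → Set
  Square c = ∃ λ y → y * y ≡ c

  square? : ∀ c → Dec (Square c)
  square? c = map′ (λ (i , e) → fromFin i , e)
    (λ (y , e) → toFin y , trans (cong₂ _*_ (fromFin-toFin y) (fromFin-toFin y)) e)
    (Finₚ.any? (λ i → fromFin i * fromFin i ≟ c))

  nonsquare⇒≢0 : ∀ {c} → ¬ Square c → ¬ (c ≡ 0#)
  nonsquare⇒≢0 ¬sq c≡0 = ¬sq (0# , trans (zeroˡ _) (sym c≡0))

  square-* : ∀ {c d} → Square c → Square d → Square (c * d)
  square-* {c} {d} (y , y²≡c) (z , z²≡d) = y * z ,
    trans (solve 2 (λ y z → (y :* z) :* (y :* z) := (y :* y) :* (z :* z)) refl y z) (cong₂ _*_ y²≡c z²≡d)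

  square-cancel : ∀ {c d} → ¬ (c ≡ 0#) → Square c → Square (d * c) → Square d
  square-cancel {c} {d} c≢0 (y , y²≡c) (w , w²≡dc) = w * y ⁻¹ , *-cancelˡ c≢0 (begin
    c * ((w * y ⁻¹) * (w * y ⁻¹))          ≡⟨ cong (_* ((w * y ⁻¹) * (w * y ⁻¹))) y²≡c ⟨
    y * y * ((w * y ⁻¹) * (w * y ⁻¹))      ≡⟨ solve 3 (λ y w z → y :* y :* ((w :* z) :* (w :* z))
                                                := (w :* w) :* ((y :* z) :* (y :* z))) refl y w (y ⁻¹) ⟩
    (w * w) * ((y * y ⁻¹) * (y * y ⁻¹))    ≡⟨ cong₂ (λ u v → u * (v * v)) w²≡dc (*-inverse y y≢0) ⟩
    (d * c) * (1# * 1#)                    ≡⟨ trans (cong (d * c *_) (*-identityˡ 1#)) (*-identityʳ _) ⟩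
    d * c                                  ≡⟨ *-comm d c ⟩
    c * d                                  ∎)
    where
    open ≡-Reasoning
    y≢0 : ¬ (y ≡ 0#)
    y≢0 y≡0 = c≢0 (trans (sym y²≡c) (trans (cong (_* y) y≡0) (zeroˡ y)))

  #F-δ : ∀ a → #F (λ x → 𝟙 (x ≟ a)) ≡ 1
  #F-δ a = trans (#F-single (λ x → 𝟙 (x ≟ a)) a (λ x → 𝟙-no (x ≟ a))) (𝟙-yes (a ≟ a) refl)

  -- This is 1 + χ(c) for the quadratic character χ; at the value of the cubic it counts the points
  -- above a given x.
  N : Carrier → ℕ
  N c = #F (λ y → 𝟙 (y * y ≟ c))

  N-zero : N 0# ≡ 1
  N-zero = trans (#F-cong (λ y → 𝟙-cong (y * y ≟ 0#) (y ≟ 0#) ([ id , id ]′ ∘ integral)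
    (λ y≡0 → trans (cong (_* y) y≡0) (zeroˡ y)))) (#F-δ 0#)

  N-nonsquare : ∀ {c} → ¬ Square c → N c ≡ 0
  N-nonsquare {c} ¬sq = trans (#F-single (λ y → 𝟙 (y * y ≟ c)) 0# (λ y _ → vanish y)) (vanish 0#)
    where
    vanish : ∀ y → 𝟙 (y * y ≟ c) ≡ 0
    vanish y = 𝟙-no (y * y ≟ c) (λ e → ¬sq (y , e))

  N-square : ∀ {c} → ¬ (c ≡ 0#) → Square c → N c ≡ 2
  N-square {c} c≢0 (z , z²≡c) = begin
    N c                                              ≡⟨ #F-cong split ⟩
    #F (λ y → 𝟙 (y ≟ z) ℕ.+ 𝟙 (y ≟ - z))             ≡⟨ #F-+ (λ y → 𝟙 (y ≟ z)) (λ y → 𝟙 (y ≟ - z)) ⟩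
    #F (λ y → 𝟙 (y ≟ z)) ℕ.+ #F (λ y → 𝟙 (y ≟ - z))  ≡⟨ cong₂ ℕ._+_ (#F-δ z) (#F-δ (- z)) ⟩
    2                                                ∎
    where
    open ≡-Reasoning
    z≢0 : ¬ (z ≡ 0#)
    z≢0 z≡0 = c≢0 (trans (sym z²≡c) (trans (cong (_* z) z≡0) (zeroˡ z)))
    split : ∀ y → 𝟙 (y * y ≟ c) ≡ 𝟙 (y ≟ z) ℕ.+ 𝟙 (y ≟ - z)
    split y with y ≟ z | y ≟ - z
    ... | yes y≡z | yes y≡-z = contradiction (trans (sym y≡z) y≡-z) (x≢-x z≢0)
    ... | yes refl | no _    = 𝟙-yes (y * y ≟ c) z²≡c
    ... | no _ | yes refl    = 𝟙-yes (y * y ≟ c)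
      (trans (solve 1 (λ z → (:- z) :* (:- z) := z :* z) refl z) z²≡c)
    ... | no y≢z | no y≢-z   = 𝟙-no (y * y ≟ c)
      (λ y²≡c → [ y≢z , y≢-z ]′ (x²≡y²⇒x≡±y (trans y²≡c (sym z²≡c))))

  N≤2 : ∀ c → N c ℕ.≤ 2
  N≤2 c with c ≟ 0# | square? c
  ... | yes c≡0 | _      = ℕₚ.≤-trans (ℕₚ.≤-reflexive (trans (cong N c≡0) N-zero)) (s≤s z≤n)
  ... | no c≢0 | yes sq  = ℕₚ.≤-reflexive (N-square c≢0 sq)
  ... | no _   | no ¬sq  = ℕₚ.≤-trans (ℕₚ.≤-reflexive (N-nonsquare ¬sq)) z≤n

  -- Double counting of the pairs (y , c) with y² = c: each y determines its c.
  #F-N : #F N ≡ q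
  #F-N = begin
    ℕsum {q} (λ i → ℕsum {q} (λ j → 𝟙 (fromFin j * fromFin j ≟ fromFin i)))  ≡⟨ #-comm {q} {q} (λ i j → 𝟙 (fromFin j * fromFin j ≟ fromFin i)) ⟩
    #F (λ y → #F (λ c → 𝟙 (y * y ≟ c)))          ≡⟨ #F-cong (λ y → trans
                                                     (#F-cong (λ c → 𝟙-cong (y * y ≟ c) (c ≟ y * y) sym sym)) (#F-δ (y * y))) ⟩
    #F (λ _ → 1)                                 ≡⟨ sum-replicate-ℕ q 1 ⟩
    q ℕ.* 1                                      ≡⟨ ℕₚ.*-identityʳ q ⟩
    q                                            ∎
    where
    open ≡-Reasoning
    open Algebra.Properties.CommutativeMonoid.Sum ℕₚ.+-0-commutativeMonoid using () renaming (∑-comm to #-comm)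

  -- For d a nonsquare each N c + N (d c) is at most 2, while they sum to 2q over all c.
  N-twist : ∀ {d} → ¬ Square d → ∀ c → N c ℕ.+ N (d * c) ≡ 2
  N-twist {d} ¬sq c = begin
    g c                      ≡⟨ cong g (fromFin-toFin c) ⟨
    g (fromFin (toFin c))    ≡⟨ sum-saturated (g ∘ fromFin) (g≤2 ∘ fromFin) total (toFin c) ⟩
    2                        ∎
    where
    open ≡-Reasoning
    g : Carrier → ℕ
    g c = N c ℕ.+ N (d * c)
    d≢0 : ¬ (d ≡ 0#)
    d≢0 = nonsquare⇒≢0 ¬sq
    total : #F g ≡ q ℕ.* 2
    total = begin
      #F g                             ≡⟨ #F-+ N (N ∘ (d *_)) ⟩
      #F N ℕ.+ #F (N ∘ (d *_))         ≡⟨ cong (#F N ℕ.+_) (#F-scale N d≢0) ⟨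
      #F N ℕ.+ #F N                    ≡⟨ cong₂ ℕ._+_ #F-N #F-N ⟩
      q ℕ.+ q                          ≡⟨ cong (q ℕ.+_) (ℕₚ.+-identityʳ q) ⟨
      2 ℕ.* q                          ≡⟨ ℕₚ.*-comm 2 q ⟩
      q ℕ.* 2                          ∎
    g≤2 : ∀ c → g c ℕ.≤ 2
    g≤2 c with c ≟ 0# | square? c
    ... | yes c≡0 | _ = ℕₚ.≤-reflexive (cong₂ ℕ._+_ (trans (cong N c≡0) N-zero)
                          (trans (cong N (trans (cong (d *_) c≡0) (zeroʳ d))) N-zero))
    ... | no _ | no ¬sq-c = subst (λ z → z ℕ.+ N (d * c) ℕ.≤ 2) (sym (N-nonsquare ¬sq-c)) (N≤2 (d * c))
    ... | no c≢0 | yes sq-c = ℕₚ.≤-reflexive (cong₂ ℕ._+_ (N-square c≢0 sq-c)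
                                (N-nonsquare (¬sq ∘ square-cancel c≢0 sq-c)))

  -- If neither c nor d c had a square root, both counts in `N-twist` would be 0 and could not add
  -- up to 2.
  nonsquare-* : ∀ {c d} → ¬ Square c → ¬ Square d → Square (d * c)
  nonsquare-* {c} {d} ¬sq-c ¬sq-d with square? (d * c)
  ... | yes sq = sq
  ... | no ¬sq with trans (sym (N-twist ¬sq-d c)) (cong₂ ℕ._+_ (N-nonsquare ¬sq-c) (N-nonsquare ¬sq))
  ...   | ()

  x^m-square : ∀ {c} → ¬ (c ≡ 0#) → Square c → c ^ᶠ m ≡ 1#
  x^m-square {c} c≢0 (y , y²≡c) = begin
    c ^ᶠ m              ≡⟨ cong (_^ᶠ m) y²≡c ⟨
    (y * y) ^ᶠ m        ≡⟨ ^-distrib-* y y m ⟩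
    y ^ᶠ m * y ^ᶠ m      ≡⟨ ^-homo-* y m m ⟨
    y ^ᶠ (m ℕ.+ m)      ≡⟨ little-fermat (λ y≡0 → c≢0 (trans (sym y²≡c) (trans (cong (_* y) y≡0) (zeroˡ y)))) ⟩
    1#                 ∎
    where open ≡-Reasoning

  -- The square of d^m is 1, so d^m is 1 or -1. If it were 1, then x^m = 1 for every unit: a square
  -- has this anyway, and for a nonsquare x the product d x is a square. That contradicts
  -- `power-nontrivial` for the exponent m < q - 1.
  x^m-nonsquare : ∀ {d} → ¬ Square d → d ^ᶠ m ≡ - 1#
  x^m-nonsquare {d} ¬sq-d with x²≡y²⇒x≡±y {d ^ᶠ m} {1#}
    (trans (sym (^-homo-* d m m)) (trans (little-fermat (nonsquare⇒≢0 ¬sq-d)) (sym (*-identityˡ 1#))))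
  ... | inj₂ d^m≡-1 = d^m≡-1
  ... | inj₁ d^m≡1 = contradiction (all-1 g≢0) g^m≢1
    where
    open ≡-Reasoning
    witness = power-nontrivial m 0<m (ℕₚ.m<m+n m 0<m)
    g = proj₁ witness
    g≢0 = proj₁ (proj₂ witness)
    g^m≢1 = proj₂ (proj₂ witness)
    all-1 : ∀ {x} → ¬ (x ≡ 0#) → x ^ᶠ m ≡ 1#
    all-1 {x} x≢0 with square? x
    ... | yes sq = x^m-square x≢0 sq
    ... | no ¬sq = begin
      x ^ᶠ m            ≡⟨ *-identityˡ _ ⟨
      1# * x ^ᶠ m       ≡⟨ cong (_* x ^ᶠ m) d^m≡1 ⟨
      d ^ᶠ m * x ^ᶠ m    ≡⟨ ^-distrib-* d x m ⟨
      (d * x) ^ᶠ m      ≡⟨ x^m-square (*-≢0 (nonsquare⇒≢0 ¬sq-d) x≢0) (nonsquare-* ¬sq ¬sq-d) ⟩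
      1#               ∎

  0^m : 0# ^ᶠ m ≡ 0#
  0^m with m | 0<m
  ... | suc k | _ = zeroˡ _

  -- Euler's criterion in a form uniform in c: the value 2, 0 or 1 of `N` corresponds to c^m = 1, -1
  -- or 0.
  fromℕ-N : ∀ c → fromℕ (N c) ≡ 1# + c ^ᶠ m
  fromℕ-N c with c ≟ 0# | square? c
  ... | yes refl | _     = trans (cong fromℕ N-zero) (cong (1# +_) (sym 0^m))
  ... | no c≢0 | yes sq  = trans (cong fromℕ (N-square c≢0 sq))
                             (cong (1# +_) (trans (+-identityʳ 1#) (sym (x^m-square c≢0 sq))))
  ... | no _   | no ¬sq  = trans (cong fromℕ (N-nonsquare ¬sq))
                             (trans (sym (-‿inverseʳ 1#)) (cong (1# +_) (sym (x^m-nonsquare ¬sq))))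

  -- The exponent m = n + n is even, so (-1)^m = 1, whereas a nonsquare would give -1.
  -1-square : Square (- 1#)
  -1-square with square? (- 1#)
  ... | yes sq = sq
  ... | no ¬sq = contradiction (begin
    1#                              ≡⟨ 1^ n ⟨
    1# ^ᶠ n                          ≡⟨ cong (_^ᶠ n) (trans (solve 1 (λ z → (:- z) :* (:- z) := z :* z) refl 1#) (*-identityˡ 1#)) ⟨
    (- 1# * - 1#) ^ᶠ n               ≡⟨ ^-distrib-* (- 1#) (- 1#) n ⟩
    (- 1#) ^ᶠ n * (- 1#) ^ᶠ n         ≡⟨ ^-homo-* (- 1#) n n ⟨
    (- 1#) ^ᶠ m                      ≡⟨ x^m-nonsquare ¬sq ⟩
    - 1#                            ∎) (x≢-x 1≢0)
    where open ≡-Reasoning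

sumFin≡ℕsum : ∀ {q} (F : FiniteField q) n f → sumFin F n f ≡ ℕsum f
sumFin≡ℕsum F zero    f = refl
sumFin≡ℕsum F (suc n) f = cong (f Fin.zero ℕ.+_) (sumFin≡ℕsum F n (f ∘ Fin.suc))

-- Point counts of y² = x³ + a x: modulo 4, under quadratic twist, and in the field.

module CountingTheory {q : ℕ} (F : FiniteField q) (n : ℕ)
  (order : q ≡ suc ((n ℕ.+ n) ℕ.+ (n ℕ.+ n))) where

  open QuadraticTheory F n order public

  cubic : Carrier → Carrier → Carrier
  cubic a x = x * x * x + a * x

  cubic-zero : ∀ a → cubic a 0# ≡ 0#
  cubic-zero a = trans (cong₂ _+_ (zeroʳ _) (zeroʳ a)) (+-identityʳ 0#)

  affineCount : Carrier → ℕ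
  affineCount a = #F (N ∘ cubic a)

  pointCount≡ : ∀ E → Curve.B E ≡ 0# → pointCount F E ≡ suc (affineCount (Curve.A E))
  pointCount≡ (curve a _ nonsingular) refl = cong suc (begin
    sumFin F q (λ i → sumFin F q (λ j → indicator F E (fromFin i) (fromFin j)))
      ≡⟨ sumFin≡ℕsum F q _ ⟩
    #F (λ x → sumFin F q (λ j → indicator F E x (fromFin j)))
      ≡⟨ #F-cong (λ x → trans (sumFin≡ℕsum F q _) (#F-cong (λ y → cong (λ c → 𝟙 (y * y ≟ c)) (+-identityʳ (cubic a x))))) ⟩
    affineCount a ∎)
    where
    open ≡-Reasoning
    E = curve a 0# nonsingular

  lower : Carrier → ℕ
  lower x = 𝟙 (toFin x Finₚ.<? toFin (- x))

  lower-± : ∀ {x} → ¬ (x ≡ 0#) → lower x ℕ.+ lower (- x) ≡ 1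
  lower-± {x} x≢0 with Finₚ.<-cmp (toFin x) (toFin (- x))
  ... | tri< lt _ gt = cong₂ ℕ._+_ (𝟙-yes (toFin x Finₚ.<? toFin (- x)) lt)
                         (𝟙-no (toFin (- x) Finₚ.<? toFin (- - x)) (gt ∘ subst (λ z → toFin (- x) Fin.< toFin z) (-‿involutive x)))
  ... | tri≈ _ eq _ = contradiction (toFin-injective eq) (x≢-x x≢0)
  ... | tri> lt _ gt = cong₂ ℕ._+_ (𝟙-no (toFin x Finₚ.<? toFin (- x)) lt)
                         (𝟙-yes (toFin (- x) Finₚ.<? toFin (- - x)) (subst (λ z → toFin (- x) Fin.< toFin z) (sym (-‿involutive x)) gt))

  -- One representative of each pair ±x is singled out by the enumeration.
  #F-even : ∀ g → g 0# ≡ 0 → (∀ x → g (- x) ≡ g x) → ∃ λ k → #F g ≡ k ℕ.+ k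
  #F-even g g0≡0 g-even = #F h , (begin
    #F g                             ≡⟨ #F-cong split ⟩
    #F (λ x → h x ℕ.+ h (- x))       ≡⟨ #F-+ h (h ∘ -_) ⟩
    #F h ℕ.+ #F (h ∘ -_)             ≡⟨ cong (#F h ℕ.+_) (#F-reindex h -_ -_ -‿involutive -‿involutive) ⟨
    #F h ℕ.+ #F h                    ∎)
    where
    open ≡-Reasoning
    h : Carrier → ℕ
    h x = g x ℕ.* lower x
    split : ∀ x → g x ≡ h x ℕ.+ h (- x)
    split x with x ≟ 0#
    ... | yes refl = trans g0≡0 (sym (cong₂ ℕ._+_ (cong (ℕ._* lower 0#) g0≡0)
                       (cong (ℕ._* lower (- 0#)) (trans (g-even 0#) g0≡0))))
    ... | no x≢0 = begin
      g x                                              ≡⟨ ℕₚ.*-identityʳ (g x) ⟨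
      g x ℕ.* 1                                        ≡⟨ cong (g x ℕ.*_) (lower-± x≢0) ⟨
      g x ℕ.* (lower x ℕ.+ lower (- x))                ≡⟨ ℕₚ.*-distribˡ-+ (g x) (lower x) (lower (- x)) ⟩
      g x ℕ.* lower x ℕ.+ g x ℕ.* lower (- x)          ≡⟨ cong (λ z → g x ℕ.* lower x ℕ.+ z ℕ.* lower (- x)) (g-even x) ⟨
      h x ℕ.+ h (- x)                                  ∎

  #roots : Carrier → ℕ
  #roots a = #F (λ x → 𝟙 (cubic a x ≟ 0#))

  -- Away from the roots of the cubic, `N` is twice the indicator `s` of a nonzero square value. The
  -- cubic is odd and -1 is a square, so `s` is even as a function and vanishes at 0. Its total is
  -- therefore an even number, and doubling that gives a multiple of 4.
  affineCount-mod4 : ∀ a → ∃ λ k → affineCount a ≡ (k ℕ.+ k) ℕ.+ (k ℕ.+ k) ℕ.+ #roots a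
  affineCount-mod4 a =
    let k , S≡k+k = #F-even s s-zero s-even
    in k , (begin
      affineCount a                                               ≡⟨ #F-cong (N-split ∘ cubic a) ⟩
      #F (λ x → s x ℕ.+ s x ℕ.+ 𝟙 (cubic a x ≟ 0#))               ≡⟨ #F-+ (λ x → s x ℕ.+ s x) (λ x → 𝟙 (cubic a x ≟ 0#)) ⟩
      #F (λ x → s x ℕ.+ s x) ℕ.+ #roots a                         ≡⟨ cong (ℕ._+ #roots a) (#F-+ s s) ⟩
      #F s ℕ.+ #F s ℕ.+ #roots a                                  ≡⟨ cong (λ z → z ℕ.+ z ℕ.+ #roots a) S≡k+k ⟩
      (k ℕ.+ k) ℕ.+ (k ℕ.+ k) ℕ.+ #roots a                        ∎)
    where
    open ≡-Reasoning
    unit-square? : ∀ c → Dec (¬ (c ≡ 0#) × Square c)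
    unit-square? c = ¬? (c ≟ 0#) ×-dec square? c

    N-split : ∀ c → N c ≡ 𝟙 (unit-square? c) ℕ.+ 𝟙 (unit-square? c) ℕ.+ 𝟙 (c ≟ 0#)
    N-split c = by-cases (c ≟ 0#) (square? c)
      where
      given : ∀ {u v} → 𝟙 (unit-square? c) ≡ u → 𝟙 (c ≟ 0#) ≡ v → N c ≡ u ℕ.+ u ℕ.+ v →
        N c ≡ 𝟙 (unit-square? c) ℕ.+ 𝟙 (unit-square? c) ℕ.+ 𝟙 (c ≟ 0#)
      given refl refl e = e
      by-cases : Dec (c ≡ 0#) → Dec (Square c) → N c ≡ 𝟙 (unit-square? c) ℕ.+ 𝟙 (unit-square? c) ℕ.+ 𝟙 (c ≟ 0#)
      by-cases (yes c≡0) _ = given (𝟙-no (unit-square? c) (λ (c≢0 , _) → c≢0 c≡0)) (𝟙-yes (c ≟ 0#) c≡0)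
        (trans (cong N c≡0) N-zero)
      by-cases (no c≢0) (yes sq) = given (𝟙-yes (unit-square? c) (c≢0 , sq)) (𝟙-no (c ≟ 0#) c≢0)
        (N-square c≢0 sq)
      by-cases (no c≢0) (no ¬sq) = given (𝟙-no (unit-square? c) (λ (_ , sq) → ¬sq sq)) (𝟙-no (c ≟ 0#) c≢0)
        (N-nonsquare ¬sq)

    s : Carrier → ℕ
    s x = 𝟙 (unit-square? (cubic a x))

    s-zero : s 0# ≡ 0
    s-zero = 𝟙-no (unit-square? (cubic a 0#)) (λ (≢0 , _) → ≢0 (cubic-zero a))

    cubic-odd : ∀ x → cubic a (- x) ≡ - cubic a x
    cubic-odd x = solve 2 (λ a x → (:- x) :* (:- x) :* (:- x) :+ a :* (:- x) := :- (x :* x :* x :+ a :* x)) refl a x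

    neg-unit-square : ∀ {c} → ¬ (c ≡ 0#) × Square c → ¬ (- c ≡ 0#) × Square (- c)
    neg-unit-square {c} (c≢0 , sq) =
      (λ -c≡0 → c≢0 (trans (sym (-‿involutive c)) (trans (cong -_ -c≡0) -0#≈0#))) ,
      subst Square (trans (sym (-‿distribˡ-* 1# c)) (cong -_ (*-identityˡ c))) (square-* -1-square sq)

    s-even : ∀ x → s (- x) ≡ s x
    s-even x = 𝟙-cong (unit-square? (cubic a (- x))) (unit-square? (cubic a x))
      (subst (λ c → ¬ (c ≡ 0#) × Square c) (trans (cong -_ (cubic-odd x)) (-‿involutive _)) ∘ neg-unit-square)
      (subst (λ c → ¬ (c ≡ 0#) × Square c) (sym (cubic-odd x)) ∘ neg-unit-square)

  cubic-root : ∀ {a x} → cubic a x ≡ 0# → x ≡ 0# ⊎ x * x ≡ - a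
  cubic-root {a} {x} e with integral {x} {x * x + a}
    (trans (solve 2 (λ a x → x :* (x :* x :+ a) := x :* x :* x :+ a :* x) refl a x) e)
  ... | inj₁ x≡0 = inj₁ x≡0
  ... | inj₂ x²+a≡0 = inj₂ (x+y≡0⇒x≡-y x²+a≡0)

  cubic-zero′ : ∀ {a x} → x * x ≡ - a → cubic a x ≡ 0#
  cubic-zero′ {a} {x} x²≡-a = begin
    x * x * x + a * x      ≡⟨ cong (λ z → z * x + a * x) x²≡-a ⟩
    - a * x + a * x        ≡⟨ solve 2 (λ a x → (:- a) :* x :+ a :* x := con (ℤ.+ 0)) refl a x ⟩
    0#                     ∎
    where open ≡-Reasoning

  #roots-nonsquare : ∀ {a} → ¬ Square (- a) → #roots a ≡ 1
  #roots-nonsquare {a} ¬sq = trans (#F-cong (λ x → 𝟙-cong (cubic a x ≟ 0#) (x ≟ 0#)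
    ([ id , (λ x²≡-a → contradiction (x , x²≡-a) ¬sq) ]′ ∘ cubic-root)
    (λ x≡0 → trans (cong (cubic a) x≡0) (cubic-zero a)))) (#F-δ 0#)

  #roots-square : ∀ {a} → ¬ (a ≡ 0#) → Square (- a) → #roots a ≡ 3
  #roots-square {a} a≢0 (b , b²≡-a) = begin
    #roots a
      ≡⟨ #F-cong split ⟩
    #F (λ x → 𝟙 (x ≟ 0#) ℕ.+ (𝟙 (x ≟ b) ℕ.+ 𝟙 (x ≟ - b)))
      ≡⟨ trans (#F-+ (λ x → 𝟙 (x ≟ 0#)) (λ x → 𝟙 (x ≟ b) ℕ.+ 𝟙 (x ≟ - b)))
           (cong (#F (λ x → 𝟙 (x ≟ 0#)) ℕ.+_) (#F-+ (λ x → 𝟙 (x ≟ b)) (λ x → 𝟙 (x ≟ - b)))) ⟩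
    #F (λ x → 𝟙 (x ≟ 0#)) ℕ.+ (#F (λ x → 𝟙 (x ≟ b)) ℕ.+ #F (λ x → 𝟙 (x ≟ - b)))
      ≡⟨ cong₂ ℕ._+_ (#F-δ 0#) (cong₂ ℕ._+_ (#F-δ b) (#F-δ (- b))) ⟩
    3 ∎
    where
    open ≡-Reasoning
    -x≡0⇒x≡0 : ∀ {x} → - x ≡ 0# → x ≡ 0#
    -x≡0⇒x≡0 {x} e = trans (sym (-‿involutive x)) (trans (cong -_ e) -0#≈0#)
    b≢0 : ¬ (b ≡ 0#)
    b≢0 b≡0 = a≢0 (-x≡0⇒x≡0 (trans (sym b²≡-a) (trans (cong (_* b) b≡0) (zeroˡ b))))
    split : ∀ x → 𝟙 (cubic a x ≟ 0#) ≡ 𝟙 (x ≟ 0#) ℕ.+ (𝟙 (x ≟ b) ℕ.+ 𝟙 (x ≟ - b))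
    split x with x ≟ 0# | x ≟ b | x ≟ - b
    ... | yes x≡0 | yes x≡b | _        = contradiction (trans (sym x≡b) x≡0) b≢0
    ... | yes x≡0 | no _    | yes x≡-b = contradiction (-x≡0⇒x≡0 (trans (sym x≡-b) x≡0)) b≢0
    ... | yes refl | no _   | no _     = 𝟙-yes (cubic a 0# ≟ 0#) (cubic-zero a)
    ... | no _ | yes x≡b | yes x≡-b    = contradiction (trans (sym x≡b) x≡-b) (x≢-x b≢0)
    ... | no _ | yes refl | no _       = 𝟙-yes (cubic a x ≟ 0#) (cubic-zero′ b²≡-a)
    ... | no _ | no _ | yes refl       = 𝟙-yes (cubic a x ≟ 0#)
      (cubic-zero′ (trans (solve 1 (λ z → (:- z) :* (:- z) := z :* z) refl b) b²≡-a))
    ... | no x≢0 | no x≢b | no x≢-b    = 𝟙-no (cubic a x ≟ 0#)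
      ([ x≢0 , (λ x²≡-a → [ x≢b , x≢-b ]′ (x²≡y²⇒x≡±y (trans x²≡-a (sym b²≡-a)))) ]′ ∘ cubic-root)

  -- Substituting d x for x turns the cubic of d² a into d³ times the cubic of a. Since d³ = d d² is
  -- again a nonsquare, `N-twist` applies at each x.
  affineCount-twist : ∀ {d} → ¬ Square d → ∀ a → affineCount a ℕ.+ affineCount (d * d * a) ≡ q ℕ.+ q
  affineCount-twist {d} ¬sq a = begin
    affineCount a ℕ.+ #F (N ∘ cubic (d * d * a))
      ≡⟨ cong (affineCount a ℕ.+_) (#F-scale (N ∘ cubic (d * d * a)) d≢0) ⟩
    affineCount a ℕ.+ #F (λ x → N (cubic (d * d * a) (d * x)))
      ≡⟨ cong (affineCount a ℕ.+_) (#F-cong (λ x → cong N (scale x))) ⟩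
    affineCount a ℕ.+ #F (λ x → N (d * (d * d) * cubic a x))
      ≡⟨ #F-+ (N ∘ cubic a) (λ x → N (d * (d * d) * cubic a x)) ⟨
    #F (λ x → N (cubic a x) ℕ.+ N (d * (d * d) * cubic a x))
      ≡⟨ #F-cong (λ x → N-twist (¬sq ∘ square-cancel (*-≢0 d≢0 d≢0) (d , refl)) (cubic a x)) ⟩
    #F (λ _ → 2)
      ≡⟨ sum-replicate-ℕ q 2 ⟩
    q ℕ.* 2
      ≡⟨ ℕₚ.*-comm q 2 ⟩
    q ℕ.+ (q ℕ.+ 0)
      ≡⟨ cong (q ℕ.+_) (ℕₚ.+-identityʳ q) ⟩
    q ℕ.+ q ∎
    where
    open ≡-Reasoning
    d≢0 : ¬ (d ≡ 0#)
    d≢0 = nonsquare⇒≢0 ¬sq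
    scale : ∀ x → cubic (d * d * a) (d * x) ≡ d * (d * d) * cubic a x
    scale x = solve 3 (λ d a x → (d :* x) :* (d :* x) :* (d :* x) :+ d :* d :* a :* (d :* x)
      := d :* (d :* d) :* (x :* x :* x :+ a :* x)) refl d a x

  -- Replacing x by g x permutes the terms and multiplies the sum by g^j, which differs from 1.
  powerSum-zero : ∀ j → ∃ (λ g → ¬ (g ≡ 0#) × ¬ (g ^ᶠ j ≡ 1#)) → ΣF (_^ᶠ j) ≡ 0#
  powerSum-zero j (g , g≢0 , g^j≢1) with ΣF (_^ᶠ j) ≟ 0#
  ... | yes S≡0 = S≡0
  ... | no S≢0  = contradiction (*-cancelˡ S≢0 (begin
    S * g ^ᶠ j                  ≡⟨ *-comm _ _ ⟩
    g ^ᶠ j * S                  ≡⟨ *-distribˡ-sum (g ^ᶠ j) (λ i → fromFin i ^ᶠ j) ⟩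
    ΣF (λ x → g ^ᶠ j * x ^ᶠ j)   ≡⟨ ΣF-cong (λ x → ^-distrib-* g x j) ⟨
    ΣF (λ x → (g * x) ^ᶠ j)     ≡⟨ ΣF-scale (_^ᶠ j) g≢0 ⟨
    S                          ≡⟨ *-identityʳ S ⟨
    S * 1#                     ∎)) g^j≢1
    where
    open ≡-Reasoning
    S = ΣF (_^ᶠ j)

  -- Every term is 1 except the one at 0. The correction δ supplies the missing 1, and then q ones
  -- add up to 0.
  powerSum-order-1 : ΣF (_^ᶠ (m ℕ.+ m)) ≡ - 1#
  powerSum-order-1 = x+y≡0⇒x≡-y (begin
    ΣF (_^ᶠ (m ℕ.+ m)) + 1#                       ≡⟨ cong (ΣF (_^ᶠ (m ℕ.+ m)) +_) δ-sum ⟨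
    ΣF (_^ᶠ (m ℕ.+ m)) + ΣF δ                     ≡⟨ ΣF-∙ (_^ᶠ (m ℕ.+ m)) δ ⟨
    ΣF (λ x → x ^ᶠ (m ℕ.+ m) + δ x)               ≡⟨ ΣF-cong pointwise ⟩
    ΣF (λ _ → 1#)                                ≡⟨ ΣF-1 ⟩
    fromℕ q                                      ≡⟨ fromℕ-order ⟩
    0#                                           ∎)
    where
    open ≡-Reasoning
    δ : Carrier → Carrier
    δ x = fromℕ (𝟙 (x ≟ 0#))
    δ-sum : ΣF δ ≡ 1#
    δ-sum = trans (ΣF-single δ 0# (λ x x≢0 → cong fromℕ (𝟙-no (x ≟ 0#) x≢0)))
      (trans (cong fromℕ (𝟙-yes (0# ≟ 0#) refl)) (+-identityʳ 1#))
    pointwise : ∀ x → x ^ᶠ (m ℕ.+ m) + δ x ≡ 1#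
    pointwise x with x ≟ 0#
    ... | yes refl = trans (cong₂ _+_ (trans (^-homo-* 0# m m) (trans (cong (_* 0# ^ᶠ m) 0^m) (zeroˡ _))) (+-identityʳ 1#)) (+-identityˡ 1#)
    ... | no x≢0   = trans (+-identityʳ _) (little-fermat x≢0)

  -- The exponents run from m to 3m, and the only multiple of q - 1 = 2m in that range is 2m itself,
  -- reached at i = n. Smaller exponents fall under `power-nontrivial` directly; larger ones do so
  -- after removing x^(2m) = 1, which leaves the exponent 2(i - n), at most m.
  powerSum-even : ∀ i → i ℕ.≤ m → ¬ (i ≡ n) → ΣF (_^ᶠ (m ℕ.+ (i ℕ.+ i))) ≡ 0#
  powerSum-even i i≤m i≢n with ℕₚ.<-cmp i n
  ... | tri≈ _ i≡n _ = contradiction i≡n i≢n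
  ... | tri< i<n _ _ = powerSum-zero (m ℕ.+ (i ℕ.+ i)) (power-nontrivial (m ℕ.+ (i ℕ.+ i))
          (ℕₚ.<-≤-trans 0<m (ℕₚ.m≤m+n m (i ℕ.+ i))) (ℕₚ.+-monoʳ-< m (ℕₚ.+-mono-< i<n i<n)))
  ... | tri> _ _ n<i =
    let g , g≢0 , g^k≢1 = power-nontrivial (k ℕ.+ k) (ℕₚ.<-≤-trans 0<k (ℕₚ.m≤m+n k k))
          (ℕₚ.≤-<-trans (ℕₚ.+-mono-≤ k≤n k≤n) (ℕₚ.m<m+n m 0<m))
    in powerSum-zero (m ℕ.+ (i ℕ.+ i)) (g , g≢0 , λ e → g^k≢1 (begin
      g ^ᶠ (k ℕ.+ k)                       ≡⟨ *-identityˡ _ ⟨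
      1# * g ^ᶠ (k ℕ.+ k)                  ≡⟨ cong (_* g ^ᶠ (k ℕ.+ k)) (little-fermat g≢0) ⟨
      g ^ᶠ (m ℕ.+ m) * g ^ᶠ (k ℕ.+ k)       ≡⟨ ^-homo-* g (m ℕ.+ m) (k ℕ.+ k) ⟨
      g ^ᶠ ((m ℕ.+ m) ℕ.+ (k ℕ.+ k))       ≡⟨ cong (g ^ᶠ_) exponent ⟩
      g ^ᶠ (m ℕ.+ (i ℕ.+ i))               ≡⟨ e ⟩
      1#                                  ∎))
    where
    open ≡-Reasoning
    k = i ℕ.∸ n
    n+k≡i : n ℕ.+ k ≡ i
    n+k≡i = ℕₚ.m+[n∸m]≡n (ℕₚ.<⇒≤ n<i)
    0<k : 0 ℕ.< k
    0<k = ℕₚ.m<n⇒0<n∸m n<i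
    k≤n : k ℕ.≤ n
    k≤n = ℕₚ.+-cancelˡ-≤ n k n (subst (ℕ._≤ m) (sym n+k≡i) i≤m)
    exponent : (m ℕ.+ m) ℕ.+ (k ℕ.+ k) ≡ m ℕ.+ (i ℕ.+ i)
    exponent = begin
      (m ℕ.+ m) ℕ.+ (k ℕ.+ k)                  ≡⟨ ℕₚ.+-assoc m m (k ℕ.+ k) ⟩
      m ℕ.+ ((n ℕ.+ n) ℕ.+ (k ℕ.+ k))          ≡⟨ cong (m ℕ.+_) (interchange n n k k) ⟩
      m ℕ.+ ((n ℕ.+ k) ℕ.+ (n ℕ.+ k))          ≡⟨ cong (λ z → m ℕ.+ (z ℕ.+ z)) n+k≡i ⟩
      m ℕ.+ (i ℕ.+ i)                          ∎

  -- Expanding x^m (x² + a)^m gives the monomials C(m,k) a^(m-k) x^(m+2k). Summed over the field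
  -- only k = n survives, with power sum -1.
  hasse-invariant : ∀ a → ΣF (λ x → cubic a x ^ᶠ m) ≡ - (fromℕ (m C n) * a ^ᶠ n)
  hasse-invariant a = begin
    ΣF (λ x → cubic a x ^ᶠ m)
      ≡⟨ ΣF-cong expand ⟩
    ΣF (λ x → sum {suc m} (λ k → coeff (Fin.toℕ k) * x ^ᶠ (m ℕ.+ (Fin.toℕ k ℕ.+ Fin.toℕ k))))
      ≡⟨ ∑-comm {q} {suc m} (λ i k → coeff (Fin.toℕ k) * fromFin i ^ᶠ (m ℕ.+ (Fin.toℕ k ℕ.+ Fin.toℕ k))) ⟩
    sum {suc m} (λ k → ΣF (λ x → coeff (Fin.toℕ k) * x ^ᶠ (m ℕ.+ (Fin.toℕ k ℕ.+ Fin.toℕ k))))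
      ≡⟨ sum-cong-≗ {suc m} (λ k → sym (*-distribˡ-sum (coeff (Fin.toℕ k)) (λ i → fromFin i ^ᶠ (m ℕ.+ (Fin.toℕ k ℕ.+ Fin.toℕ k))))) ⟩
    sum {suc m} term
      ≡⟨ sum-single term n′ (λ k k≢n → trans (cong (coeff (Fin.toℕ k) *_)
           (powerSum-even (Fin.toℕ k) (ℕ.s≤s⁻¹ (Finₚ.toℕ<n k)) (λ e → k≢n (Finₚ.toℕ-injective (trans e (sym n′≡n))))))
           (zeroʳ _)) ⟩
    term n′
      ≡⟨ cong (λ k → coeff k * ΣF (_^ᶠ (m ℕ.+ (k ℕ.+ k)))) n′≡n ⟩
    coeff n * ΣF (_^ᶠ (m ℕ.+ m))
      ≡⟨ cong₂ _*_ (cong (λ k → fromℕ (m C n) * a ^ᶠ k) (ℕₚ.m+n∸n≡m n n)) powerSum-order-1 ⟩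
    fromℕ (m C n) * a ^ᶠ n * - 1#
      ≡⟨ sym (-‿distribʳ-* _ 1#) ⟩
    - (fromℕ (m C n) * a ^ᶠ n * 1#)
      ≡⟨ cong -_ (*-identityʳ _) ⟩
    - (fromℕ (m C n) * a ^ᶠ n) ∎
    where
    open ≡-Reasoning
    open Algebra.Properties.CommutativeSemiring.Binomial commutativeSemiring using (theorem; binomialTerm)
    coeff : ℕ → Carrier
    coeff k = fromℕ (m C k) * a ^ᶠ (m ℕ.∸ k)
    term : Fin (suc m) → Carrier
    term k = coeff (Fin.toℕ k) * ΣF (_^ᶠ (m ℕ.+ (Fin.toℕ k ℕ.+ Fin.toℕ k)))
    n<1+m : n ℕ.< suc m
    n<1+m = s≤s (ℕₚ.m≤m+n n n)
    n′ : Fin (suc m)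
    n′ = Fin.fromℕ< n<1+m
    n′≡n : Fin.toℕ n′ ≡ n
    n′≡n = Finₚ.toℕ-fromℕ< n<1+m
    expand : ∀ x → cubic a x ^ᶠ m ≡ sum {suc m} (λ k → coeff (Fin.toℕ k) * x ^ᶠ (m ℕ.+ (Fin.toℕ k ℕ.+ Fin.toℕ k)))
    expand x = begin
      cubic a x ^ᶠ m
        ≡⟨ cong (_^ᶠ m) (solve 2 (λ a x → x :* x :* x :+ a :* x := x :* (x :* x :+ a)) refl a x) ⟩
      (x * (x * x + a)) ^ᶠ m
        ≡⟨ ^-distrib-* x (x * x + a) m ⟩
      x ^ᶠ m * (x * x + a) ^ᶠ m
        ≡⟨ cong (x ^ᶠ m *_) (theorem m (x * x) a) ⟩
      x ^ᶠ m * sum {suc m} (binomialTerm (x * x) a m)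
        ≡⟨ *-distribˡ-sum (x ^ᶠ m) (binomialTerm (x * x) a m) ⟩
      sum {suc m} (λ k → x ^ᶠ m * binomialTerm (x * x) a m k)
        ≡⟨ sum-cong-≗ {suc m} (λ k → expand-term (Fin.toℕ k)) ⟩
      sum {suc m} (λ k → coeff (Fin.toℕ k) * x ^ᶠ (m ℕ.+ (Fin.toℕ k ℕ.+ Fin.toℕ k))) ∎
      where
      expand-term : ∀ k → x ^ᶠ m * ((m C k) · ((x * x) ^ᶠ k * a ^ᶠ (m ℕ.∸ k))) ≡ coeff k * x ^ᶠ (m ℕ.+ (k ℕ.+ k))
      expand-term k = begin
        x ^ᶠ m * ((m C k) · ((x * x) ^ᶠ k * a ^ᶠ (m ℕ.∸ k)))
          ≡⟨ cong (x ^ᶠ m *_) (·≡fromℕ* (m C k) _) ⟩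
        x ^ᶠ m * (fromℕ (m C k) * ((x * x) ^ᶠ k * a ^ᶠ (m ℕ.∸ k)))
          ≡⟨ cong (λ z → x ^ᶠ m * (fromℕ (m C k) * (z * a ^ᶠ (m ℕ.∸ k))))
               (trans (^-distrib-* x x k) (sym (^-homo-* x k k))) ⟩
        x ^ᶠ m * (fromℕ (m C k) * (x ^ᶠ (k ℕ.+ k) * a ^ᶠ (m ℕ.∸ k)))
          ≡⟨ solve 4 (λ u v w z → u :* (v :* (w :* z)) := v :* z :* (u :* w)) refl
               (x ^ᶠ m) (fromℕ (m C k)) (x ^ᶠ (k ℕ.+ k)) (a ^ᶠ (m ℕ.∸ k)) ⟩
        coeff k * (x ^ᶠ m * x ^ᶠ (k ℕ.+ k))
          ≡⟨ cong (coeff k *_) (^-homo-* x m (k ℕ.+ k)) ⟨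
        coeff k * x ^ᶠ (m ℕ.+ (k ℕ.+ k)) ∎

  -- Summing Euler's criterion over all x, the constant terms contribute q = 0 and only the Hasse
  -- invariant is left.
  fromℕ-affineCount : ∀ a → fromℕ (affineCount a) ≡ - (fromℕ (m C n) * a ^ᶠ n)
  fromℕ-affineCount a = begin
    fromℕ (affineCount a)                        ≡⟨ fromℕ-sum (N ∘ cubic a ∘ fromFin) ⟩
    ΣF (λ x → fromℕ (N (cubic a x)))             ≡⟨ ΣF-cong (fromℕ-N ∘ cubic a) ⟩
    ΣF (λ x → 1# + cubic a x ^ᶠ m)                ≡⟨ ΣF-∙ (λ _ → 1#) (λ x → cubic a x ^ᶠ m) ⟩
    ΣF (λ _ → 1#) + ΣF (λ x → cubic a x ^ᶠ m)     ≡⟨ cong₂ _+_ (trans ΣF-1 fromℕ-order) (hasse-invariant a) ⟩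
    0# + - (fromℕ (m C n) * a ^ᶠ n)               ≡⟨ +-identityˡ _ ⟩
    - (fromℕ (m C n) * a ^ᶠ n)                    ∎
    where open ≡-Reasoning

-- Characteristic p: Frobenius and binomial coefficients modulo p.

module CharacteristicTheory {q p′ : ℕ} (F : FiniteField q) (p-prime : Prime (suc p′))
  (char : FiniteField.fromℕ F (suc p′) ≡ FiniteField.0# F) where

  open FieldTheory F

  private
    p : ℕ
    p = suc p′

  fromℕ-multiple : ∀ k → fromℕ (k ℕ.* p) ≡ 0#
  fromℕ-multiple k = trans (fromℕ-* k p) (trans (cong (fromℕ k *_) char) (zeroʳ _))

  -- Were k prime to p, a Bézout relation would express 1 through multiples of p and of k, all of
  -- which vanish in the field.
  fromℕ≡0⇒p∣ : ∀ k → fromℕ k ≡ 0# → p ∣ k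
  fromℕ≡0⇒p∣ k k≡0 with p ∣? k
  ... | yes p∣k = p∣k
  ... | no p∤k  = contradiction (bézout (coprime-Bézout coprime)) 1≢0
    where
    open ≡-Reasoning
    coprime : Coprime p k
    coprime (d∣p , d∣k) with prime⇒irreducible p-prime d∣p
    ... | inj₁ d≡1 = d≡1
    ... | inj₂ d≡p = contradiction (subst (_∣ k) d≡p d∣k) p∤k
    fromℕ-multiple-k : ∀ y → fromℕ (y ℕ.* k) ≡ 0#
    fromℕ-multiple-k y = trans (fromℕ-* y k) (trans (cong (fromℕ y *_) k≡0) (zeroʳ _))
    bézout : Bézout.Identity 1 p k → 1# ≡ 0#
    bézout (Bézout.+- x y eq) = begin
      1#                            ≡⟨ +-identityʳ 1# ⟨
      1# + 0#                       ≡⟨ cong (1# +_) (fromℕ-multiple-k y) ⟨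
      fromℕ (1 ℕ.+ y ℕ.* k)         ≡⟨ cong fromℕ eq ⟩
      fromℕ (x ℕ.* p)               ≡⟨ fromℕ-multiple x ⟩
      0#                            ∎
    bézout (Bézout.-+ x y eq) = begin
      1#                            ≡⟨ +-identityʳ 1# ⟨
      1# + 0#                       ≡⟨ cong (1# +_) (fromℕ-multiple x) ⟨
      fromℕ (1 ℕ.+ x ℕ.* p)         ≡⟨ cong fromℕ eq ⟩
      fromℕ (y ℕ.* k)               ≡⟨ fromℕ-multiple-k y ⟩
      0#                            ∎

  fromℕ-!≢0 : ∀ {k} → k ℕ.< p → ¬ (fromℕ (k !) ≡ 0#)
  fromℕ-!≢0 {zero}  _   e = 1≢0 (trans (sym (+-identityʳ 1#)) e)
  fromℕ-!≢0 {suc k} k<p e = *-≢0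
    (λ 1+k≡0 → ℕₚ.<⇒≱ k<p (∣⇒≤ (fromℕ≡0⇒p∣ (suc k) 1+k≡0)))
    (fromℕ-!≢0 {k} (ℕₚ.<-trans (ℕₚ.n<1+n k) k<p))
    (trans (sym (fromℕ-* (suc k) (k !))) e)

  fromℕ-C-! : ∀ {n k} → k ℕ.≤ n →
    fromℕ (n C k) * (fromℕ (k !) * fromℕ ((n ℕ.∸ k) !)) ≡ fromℕ (n !)
  fromℕ-C-! {n} {k} k≤n = begin
    fromℕ (n C k) * (fromℕ (k !) * fromℕ ((n ℕ.∸ k) !))   ≡⟨ cong (fromℕ (n C k) *_) (fromℕ-* (k !) _) ⟨
    fromℕ (n C k) * fromℕ (k ! ℕ.* (n ℕ.∸ k) !)           ≡⟨ fromℕ-* (n C k) _ ⟨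
    fromℕ ((n C k) ℕ.* (k ! ℕ.* (n ℕ.∸ k) !))             ≡⟨ cong (λ z → fromℕ (z ℕ.* (k ! ℕ.* (n ℕ.∸ k) !))) (nCk≡n!/k![n-k]! k≤n) ⟩
    fromℕ (n ! ℕ./ (k ! ℕ.* (n ℕ.∸ k) !) ℕ.* (k ! ℕ.* (n ℕ.∸ k) !))   ≡⟨ cong fromℕ (m/n*n≡m (k![n∸k]!∣n! k≤n)) ⟩
    fromℕ (n !)                                           ∎
    where
    open ≡-Reasoning
    instance _ = ℕₚ._!*_!≢0 k (n ℕ.∸ k)

  fromℕ-C≢0 : ∀ {n k} → k ℕ.≤ n → n ℕ.< p → ¬ (fromℕ (n C k) ≡ 0#)
  fromℕ-C≢0 {n} {k} k≤n n<p C≡0 = fromℕ-!≢0 n<p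
    (trans (sym (fromℕ-C-! k≤n)) (trans (cong (_* (fromℕ (k !) * fromℕ ((n ℕ.∸ k) !))) C≡0) (zeroˡ _)))

  -- The product of C(p,k), k! and (p-k)! is p! = 0, and the two factorials are nonzero because they
  -- only involve numbers below p.
  fromℕ-pC≡0 : ∀ {k} → 0 ℕ.< k → k ℕ.< p → fromℕ (p C k) ≡ 0#
  fromℕ-pC≡0 {k} 0<k k<p with integral
    (trans (fromℕ-C-! (ℕₚ.<⇒≤ k<p)) (trans (fromℕ-* p (p′ !)) (trans (cong (_* fromℕ (p′ !)) char) (zeroˡ _))))
  ... | inj₁ C≡0 = C≡0
  ... | inj₂ e   = contradiction e (*-≢0 (fromℕ-!≢0 k<p) (fromℕ-!≢0 (ℕₚ.∸-monoʳ-< 0<k (ℕₚ.<⇒≤ k<p))))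

  frobenius-+ : ∀ x y → (x + y) ^ᶠ p ≡ x ^ᶠ p + y ^ᶠ p
  frobenius-+ x y = begin
    (x + y) ^ᶠ p                                       ≡⟨ theorem p x y ⟩
    term Fin.zero + sum {p} (term ∘ Fin.suc)          ≡⟨ cong₂ _+_ first last ⟩
    y ^ᶠ p + x ^ᶠ p                                     ≡⟨ +-comm _ _ ⟩
    x ^ᶠ p + y ^ᶠ p                                     ∎
    where
    open ≡-Reasoning
    open Algebra.Properties.CommutativeSemiring.Binomial commutativeSemiring using (theorem; binomialTerm)
    term : Fin (suc p) → Carrier
    term = binomialTerm x y p
    first : term Fin.zero ≡ y ^ᶠ p
    first = trans (+-identityʳ _) (*-identityˡ _)
    -- `binomialTerm` at index k carries x^k y^(p-k), so index zero is y^p. The remaining indices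
    -- are shifted by one, and `Fin.suc top` is the term x^p.
    top : Fin p
    top = Fin.fromℕ p′
    off-top : ∀ k → ¬ (k ≡ top) → term (Fin.suc k) ≡ 0#
    off-top k k≢top = trans (·≡fromℕ* (p C suc (Fin.toℕ k)) (x ^ᶠ suc (Fin.toℕ k) * y ^ᶠ (p′ ℕ.∸ Fin.toℕ k)))
      (trans (cong (_* (x ^ᶠ suc (Fin.toℕ k) * y ^ᶠ (p′ ℕ.∸ Fin.toℕ k))) (fromℕ-pC≡0 (s≤s z≤n) (s≤s (ℕₚ.≤∧≢⇒< (ℕ.s≤s⁻¹ (Finₚ.toℕ<n k))
        (λ e → k≢top (Finₚ.toℕ-injective (trans e (sym (Finₚ.toℕ-fromℕ p′)))))))))
        (zeroˡ _))
    last : sum {p} (term ∘ Fin.suc) ≡ x ^ᶠ p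
    last = begin
      sum {p} (term ∘ Fin.suc)    ≡⟨ sum-single (term ∘ Fin.suc) top off-top ⟩
      term (Fin.suc top)          ≡⟨ cong (λ k → (p C suc k) · (x ^ᶠ suc k * y ^ᶠ (p′ ℕ.∸ k))) (Finₚ.toℕ-fromℕ p′) ⟩
      (p C p) · (x ^ᶠ p * y ^ᶠ (p′ ℕ.∸ p′))   ≡⟨ cong₂ (λ c k → c · (x ^ᶠ p * y ^ᶠ k)) (nCn≡1 p) (ℕₚ.n∸n≡0 p′) ⟩
      1 · (x ^ᶠ p * 1#)            ≡⟨ trans (+-identityʳ _) (*-identityʳ _) ⟩
      x ^ᶠ p                       ∎

  private
    c : ℕ → ℕ → Carrier
    c n k = fromℕ (n C k)

    pascal : ∀ n k → c (suc n) (suc k) ≡ c n k + c n (suc k)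
    pascal n k = trans (cong fromℕ (sym (nCk+nC[k+1]≡[n+1]C[k+1] n k))) (fromℕ-+ (n C k) (n C suc k))

    c-vanish : ∀ {n k} → n ℕ.< k → c n k ≡ 0#
    c-vanish n<k = cong fromℕ (k>n⇒nCk≡0 n<k)

  -- (1 + X)^(n + p) = (1 + X)^n (1 + X^p), read off coefficientwise below and above degree p.
  C-shift-low : ∀ n {k} → k ℕ.< p → fromℕ ((n ℕ.+ p) C k) ≡ fromℕ (n C k)
  C-shift-low n       {zero}  _   = refl
  C-shift-low zero    {suc k} k<p = trans (fromℕ-pC≡0 (s≤s z≤n) k<p) (sym (c-vanish {0} {suc k} (s≤s z≤n)))
  C-shift-low (suc n) {suc k} k<p = begin
    c (suc (n ℕ.+ p)) (suc k)            ≡⟨ pascal (n ℕ.+ p) k ⟩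
    c (n ℕ.+ p) k + c (n ℕ.+ p) (suc k)  ≡⟨ cong₂ _+_ (C-shift-low n (ℕₚ.<-trans (ℕₚ.n<1+n k) k<p)) (C-shift-low n k<p) ⟩
    c n k + c n (suc k)                  ≡⟨ pascal n k ⟨
    c (suc n) (suc k)                    ∎
    where open ≡-Reasoning

  C-shift-high : ∀ n k → fromℕ ((n ℕ.+ p) C (p ℕ.+ k)) ≡ fromℕ (n C (p ℕ.+ k)) + fromℕ (n C k)
  C-shift-high zero zero = begin
    c p (p ℕ.+ 0)             ≡⟨ cong (c p) (ℕₚ.+-identityʳ p) ⟩
    c p p                     ≡⟨ cong fromℕ (nCn≡1 p) ⟩
    fromℕ 1                   ≡⟨ +-identityˡ _ ⟨
    0# + fromℕ 1              ≡⟨ cong (_+ fromℕ 1) (c-vanish {0} {p ℕ.+ 0} (s≤s z≤n)) ⟨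
    c 0 (p ℕ.+ 0) + fromℕ 1   ∎
    where open ≡-Reasoning
  C-shift-high zero (suc k) = trans (c-vanish (ℕₚ.m<m+n p (s≤s z≤n)))
    (sym (trans (cong₂ _+_ (c-vanish {0} {p ℕ.+ suc k} (s≤s z≤n)) (c-vanish {0} {suc k} (s≤s z≤n))) (+-identityˡ 0#)))
  -- At column p Pascal's rule reaches back to column p - 1, which belongs to the low range. The
  -- last summand matches because C(n,0) and C(n+1,0) are both 1.
  C-shift-high (suc n) zero = begin
    c (suc (n ℕ.+ p)) (suc (p′ ℕ.+ 0))                     ≡⟨ pascal (n ℕ.+ p) (p′ ℕ.+ 0) ⟩
    c (n ℕ.+ p) (p′ ℕ.+ 0) + c (n ℕ.+ p) (p ℕ.+ 0)         ≡⟨ cong₂ _+_ (C-shift-low n (s≤s (ℕₚ.≤-reflexive (ℕₚ.+-identityʳ p′)))) (C-shift-high n 0) ⟩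
    c n (p′ ℕ.+ 0) + (c n (p ℕ.+ 0) + c n 0)               ≡⟨ +-assoc _ _ _ ⟨
    c n (p′ ℕ.+ 0) + c n (p ℕ.+ 0) + c n 0                 ≡⟨ cong (_+ c n 0) (pascal n (p′ ℕ.+ 0)) ⟨
    c (suc n) (p ℕ.+ 0) + c (suc n) 0                      ∎
    where open ≡-Reasoning
  C-shift-high (suc n) (suc k) = begin
    c (suc (n ℕ.+ p)) (suc (p′ ℕ.+ suc k))
      ≡⟨ pascal (n ℕ.+ p) (p′ ℕ.+ suc k) ⟩
    c (n ℕ.+ p) (p′ ℕ.+ suc k) + c (n ℕ.+ p) (p ℕ.+ suc k)
      ≡⟨ cong (λ z → c (n ℕ.+ p) z + c (n ℕ.+ p) (p ℕ.+ suc k)) (ℕₚ.+-suc p′ k) ⟩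
    c (n ℕ.+ p) (p ℕ.+ k) + c (n ℕ.+ p) (p ℕ.+ suc k)
      ≡⟨ cong₂ _+_ (C-shift-high n k) (C-shift-high n (suc k)) ⟩
    (c n (p ℕ.+ k) + c n k) + (c n (p ℕ.+ suc k) + c n (suc k))
      ≡⟨ solve 4 (λ a b c d → (a :+ b) :+ (c :+ d) := (a :+ c) :+ (b :+ d)) refl _ _ _ _ ⟩
    (c n (p ℕ.+ k) + c n (p ℕ.+ suc k)) + (c n k + c n (suc k))
      ≡⟨ cong₂ _+_ (trans (cong (λ z → c n z + c n (p ℕ.+ suc k)) (sym (ℕₚ.+-suc p′ k))) (sym (pascal n (p′ ℕ.+ suc k)))) (sym (pascal n k)) ⟩
    c (suc n) (p ℕ.+ suc k) + c (suc n) (suc k) ∎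
    where open ≡-Reasoning

  -- Induction on M. Raising M by one multiplies the generating polynomial by 1 + X^p, which acts on
  -- the upper digit by Pascal's rule for C(M,K) and leaves the factor C(a,b) alone. For K = 0 the
  -- column stays below p and nothing changes.
  lucas : ∀ M K {a b} → a ℕ.< p → b ℕ.< p →
    fromℕ ((M ℕ.* p ℕ.+ a) C (K ℕ.* p ℕ.+ b)) ≡ fromℕ (M C K) * fromℕ (a C b)
  lucas zero zero {a} {b} _ _ = sym (trans (cong (_* c a b) (+-identityʳ 1#)) (*-identityˡ _))
  lucas zero (suc K) {a} {b} a<p _ = trans
    (c-vanish (ℕₚ.<-≤-trans a<p (ℕₚ.≤-trans (ℕₚ.m≤m+n p (K ℕ.* p)) (ℕₚ.m≤m+n _ b))))
    (sym (trans (cong (_* c a b) (c-vanish {0} {suc K} (s≤s z≤n))) (zeroˡ _)))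
  lucas (suc M) K {a} {b} a<p b<p = trans (cong (λ z → c z (K ℕ.* p ℕ.+ b)) top≡) (step K)
    where
    open ≡-Reasoning
    top≡ : suc M ℕ.* p ℕ.+ a ≡ (M ℕ.* p ℕ.+ a) ℕ.+ p
    top≡ = trans (ℕₚ.+-assoc p (M ℕ.* p) a) (ℕₚ.+-comm p (M ℕ.* p ℕ.+ a))
    step : ∀ K → c ((M ℕ.* p ℕ.+ a) ℕ.+ p) (K ℕ.* p ℕ.+ b) ≡ c (suc M) K * c a b
    step zero    = trans (C-shift-low (M ℕ.* p ℕ.+ a) b<p) (lucas M zero a<p b<p)
    step (suc K) = begin
      c ((M ℕ.* p ℕ.+ a) ℕ.+ p) (suc K ℕ.* p ℕ.+ b)
        ≡⟨ cong (c ((M ℕ.* p ℕ.+ a) ℕ.+ p)) (ℕₚ.+-assoc p (K ℕ.* p) b) ⟩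
      c ((M ℕ.* p ℕ.+ a) ℕ.+ p) (p ℕ.+ (K ℕ.* p ℕ.+ b))
        ≡⟨ C-shift-high (M ℕ.* p ℕ.+ a) (K ℕ.* p ℕ.+ b) ⟩
      c (M ℕ.* p ℕ.+ a) (p ℕ.+ (K ℕ.* p ℕ.+ b)) + c (M ℕ.* p ℕ.+ a) (K ℕ.* p ℕ.+ b)
        ≡⟨ cong (λ z → c (M ℕ.* p ℕ.+ a) z + c (M ℕ.* p ℕ.+ a) (K ℕ.* p ℕ.+ b)) (sym (ℕₚ.+-assoc p (K ℕ.* p) b)) ⟩
      c (M ℕ.* p ℕ.+ a) (suc K ℕ.* p ℕ.+ b) + c (M ℕ.* p ℕ.+ a) (K ℕ.* p ℕ.+ b)
        ≡⟨ cong₂ _+_ (lucas M (suc K) a<p b<p) (lucas M K a<p b<p) ⟩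
      c M (suc K) * c a b + c M K * c a b
        ≡⟨ trans (sym (distribʳ _ _ _)) (cong (_* c a b) (trans (+-comm _ _) (sym (pascal M K)))) ⟩
      c (suc M) (suc K) * c a b ∎

  -- All base-p digits of (p^r - 1)/4 equal h.
  quarter : ℕ → ℕ → ℕ
  quarter h zero    = 0
  quarter h (suc r) = quarter h r ℕ.* p ℕ.+ h

  -- Since 2h < p, doubling a number whose digits are all h produces no carry. Lucas then splits the
  -- central binomial coefficient into factors C(2h,h), each nonzero modulo p.
  quarter-C≢0 : ∀ h → h ℕ.+ h ℕ.< p → ∀ r →
    ¬ (fromℕ ((quarter h r ℕ.+ quarter h r) C quarter h r) ≡ 0#)
  quarter-C≢0 h 2h<p zero    e = 1≢0 (trans (sym (+-identityʳ 1#)) e)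
  quarter-C≢0 h 2h<p (suc r) e = *-≢0 (quarter-C≢0 h 2h<p r)
    (fromℕ-C≢0 (ℕₚ.m≤m+n h h) 2h<p)
    (trans (sym (lucas (k ℕ.+ k) k 2h<p (ℕₚ.≤-<-trans (ℕₚ.m≤m+n h h) 2h<p))) (trans (cong (λ z → c z (k ℕ.* p ℕ.+ h)) double) e))
    where
    k = quarter h r
    double : (k ℕ.+ k) ℕ.* p ℕ.+ (h ℕ.+ h) ≡ (k ℕ.* p ℕ.+ h) ℕ.+ (k ℕ.* p ℕ.+ h)
    double = trans (cong (ℕ._+ (h ℕ.+ h)) (ℕₚ.*-distribʳ-+ p k k)) (interchange (k ℕ.* p) (k ℕ.* p) h h)

-- Isomorphisms of point groups from semilinear changes of variable.

module IsomorphismTheory {q : ℕ} (F : FiniteField q) where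

  open FieldTheory F

  -- The common tail of the two slope branches of `addPt`, as a function of the slope. Compatibility
  -- with addition thus reduces to how slopes transform.
  chord : Carrier → Carrier → Carrier → Carrier → RawPoint F
  chord l x₁ y₁ x₂ = aff (l * l - x₁ - x₂) (l * (x₁ - (l * l - x₁ - x₂)) - y₁)

  module _ (E : Curve F) where
    addPt-chord : ∀ {x₁ y₁ x₂ y₂} → ¬ (x₁ ≡ x₂) →
      addPt F E (aff x₁ y₁) (aff x₂ y₂) ≡ chord ((y₂ - y₁) * (x₂ - x₁) ⁻¹) x₁ y₁ x₂
    addPt-chord {x₁} {x₂ = x₂} x₁≢x₂ rewrite dec-false (x₁ ≟ x₂) x₁≢x₂ = refl

    addPt-opposite : ∀ {x₁ y₁ x₂ y₂} → x₁ ≡ x₂ → y₁ + y₂ ≡ 0# →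
      addPt F E (aff x₁ y₁) (aff x₂ y₂) ≡ O
    addPt-opposite {x₁} {y₁} {x₂} {y₂} x₁≡x₂ y₁+y₂≡0
      rewrite dec-true (x₁ ≟ x₂) x₁≡x₂ | dec-true (y₁ + y₂ ≟ 0#) y₁+y₂≡0 = refl

    addPt-tangent : ∀ {x₁ y₁ x₂ y₂} → x₁ ≡ x₂ → ¬ (y₁ + y₂ ≡ 0#) →
      addPt F E (aff x₁ y₁) (aff x₂ y₂) ≡
        chord ((fromℕ 3 * (x₁ * x₁) + Curve.A E) * (fromℕ 2 * y₁) ⁻¹) x₁ y₁ x₂
    addPt-tangent {x₁} {y₁} {x₂} {y₂} x₁≡x₂ y₁+y₂≢0
      rewrite dec-true (x₁ ≟ x₂) x₁≡x₂ | dec-false (y₁ + y₂ ≟ 0#) y₁+y₂≢0 = refl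

  -- E₂ is the conjugate of E₁ under the field automorphism σ, rescaled by u. The case σ = id is the
  -- usual change of variables, and σ = Frobenius is the map needed for twists; both isomorphisms
  -- are instances of this module.
  module SemilinearIsomorphism
    (σ τ : Carrier → Carrier)
    (σ-+ : ∀ x y → σ (x + y) ≡ σ x + σ y) (σ-* : ∀ x y → σ (x * y) ≡ σ x * σ y) (σ-1 : σ 1# ≡ 1#)
    (στ : ∀ x → σ (τ x) ≡ x) (τσ : ∀ x → τ (σ x) ≡ x)
    (u : Carrier) (u≢0 : ¬ (u ≡ 0#)) (E₁ E₂ : Curve F)
    (A₂≡ : Curve.A E₂ ≡ u * u * (u * u) * σ (Curve.A E₁))
    (B₂≡ : Curve.B E₂ ≡ u * u * u * (u * u * u) * σ (Curve.B E₁)) where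

    open ≡-Reasoning

    private
      A₁ = Curve.A E₁
      B₁ = Curve.B E₁

      u² u³ v² v³ : Carrier
      u² = u * u
      u³ = u * u * u
      v² = u ⁻¹ * u ⁻¹
      v³ = u ⁻¹ * u ⁻¹ * u ⁻¹

      u²≢0 : ¬ (u² ≡ 0#)
      u²≢0 = *-≢0 u≢0 u≢0

      u³≢0 : ¬ (u³ ≡ 0#)
      u³≢0 = *-≢0 u²≢0 u≢0

      u²v²≡1 : u² * v² ≡ 1#
      u²v²≡1 = begin
        u * u * (u ⁻¹ * u ⁻¹)        ≡⟨ solve 2 (λ u v → u :* u :* (v :* v) := (u :* v) :* (u :* v)) refl u (u ⁻¹) ⟩
        (u * u ⁻¹) * (u * u ⁻¹)      ≡⟨ cong (λ z → z * z) (*-inverse u u≢0) ⟩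
        1# * 1#                      ≡⟨ *-identityˡ 1# ⟩
        1#                           ∎

      u³v³≡1 : u³ * v³ ≡ 1#
      u³v³≡1 = begin
        u * u * u * (u ⁻¹ * u ⁻¹ * u ⁻¹)  ≡⟨ solve 2 (λ u v → u :* u :* u :* (v :* v :* v) := u :* u :* (v :* v) :* (u :* v)) refl u (u ⁻¹) ⟩
        u² * v² * (u * u ⁻¹)              ≡⟨ cong₂ _*_ u²v²≡1 (*-inverse u u≢0) ⟩
        1# * 1#                           ≡⟨ *-identityˡ 1# ⟩
        1#                                ∎

      σ-0 : σ 0# ≡ 0#
      σ-0 = +-cancelˡ (σ 0#) _ _ (trans (sym (σ-+ 0# 0#)) (trans (cong σ (+-identityˡ 0#)) (sym (+-identityʳ _))))

      σ-neg : ∀ x → σ (- x) ≡ - σ x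
      σ-neg x = +-cancelˡ (σ x) _ _
        (trans (sym (σ-+ x (- x))) (trans (cong σ (-‿inverseʳ x)) (trans σ-0 (sym (-‿inverseʳ (σ x))))))

      σ-sub : ∀ x y → σ (x - y) ≡ σ x - σ y
      σ-sub x y = trans (σ-+ x (- y)) (cong (σ x +_) (σ-neg y))

      σ-fromℕ : ∀ k → σ (fromℕ k) ≡ fromℕ k
      σ-fromℕ zero    = σ-0
      σ-fromℕ (suc k) = trans (σ-+ 1# (fromℕ k)) (cong₂ _+_ σ-1 (σ-fromℕ k))

      σ-injective : ∀ {x y} → σ x ≡ σ y → x ≡ y
      σ-injective {x} {y} e = trans (sym (τσ x)) (trans (cong τ e) (τσ y))

      σ-≢0 : ∀ {x} → ¬ (x ≡ 0#) → ¬ (σ x ≡ 0#)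
      σ-≢0 x≢0 e = x≢0 (σ-injective (trans e (sym σ-0)))

      σ-cubic : ∀ x → σ (x * x * x + A₁ * x + B₁) ≡ σ x * σ x * σ x + σ A₁ * σ x + σ B₁
      σ-cubic x = trans (σ-+ _ _) (cong (_+ σ B₁) (trans (σ-+ _ _)
        (cong₂ _+_ (trans (σ-* _ _) (cong (_* σ x) (σ-* x x))) (σ-* A₁ x))))

      scale-cubic : ∀ x → u² * σ x * (u² * σ x) * (u² * σ x) + Curve.A E₂ * (u² * σ x) + Curve.B E₂
                          ≡ u³ * u³ * σ (x * x * x + A₁ * x + B₁)
      scale-cubic x = begin
        u² * σ x * (u² * σ x) * (u² * σ x) + Curve.A E₂ * (u² * σ x) + Curve.B E₂
          ≡⟨ cong₂ (λ A B → u² * σ x * (u² * σ x) * (u² * σ x) + A * (u² * σ x) + B) A₂≡ B₂≡ ⟩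
        u² * σ x * (u² * σ x) * (u² * σ x) + u² * u² * σ A₁ * (u² * σ x) + u³ * u³ * σ B₁
          ≡⟨ solve 4 (λ u x A B → let u² = u :* u ; u³ = u :* u :* u in
               u² :* x :* (u² :* x) :* (u² :* x) :+ u² :* u² :* A :* (u² :* x) :+ u³ :* u³ :* B
               := u³ :* u³ :* (x :* x :* x :+ A :* x :+ B)) refl u (σ x) (σ A₁) (σ B₁) ⟩
        u³ * u³ * (σ x * σ x * σ x + σ A₁ * σ x + σ B₁)
          ≡⟨ cong (u³ * u³ *_) (σ-cubic x) ⟨
        u³ * u³ * σ (x * x * x + A₁ * x + B₁) ∎

      scale-square : ∀ y → u³ * σ y * (u³ * σ y) ≡ u³ * u³ * σ (y * y)
      scale-square y = trans (solve 2 (λ w y → w :* y :* (w :* y) := w :* w :* (y :* y)) refl u³ (σ y))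
        (cong (u³ * u³ *_) (sym (σ-* y y)))

    ψ : RawPoint F → RawPoint F
    ψ O         = O
    ψ (aff x y) = aff (u² * σ x) (u³ * σ y)

    ψ⁻¹ : RawPoint F → RawPoint F
    ψ⁻¹ O         = O
    ψ⁻¹ (aff x y) = aff (τ (v² * x)) (τ (v³ * y))

    private
      cancel : ∀ {w z} → w * z ≡ 1# → ∀ x → w * σ (τ (z * x)) ≡ x
      cancel {w} {z} wz≡1 x = begin
        w * σ (τ (z * x))    ≡⟨ cong (w *_) (στ (z * x)) ⟩
        w * (z * x)          ≡⟨ *-assoc w z x ⟨
        w * z * x            ≡⟨ cong (_* x) wz≡1 ⟩
        1# * x               ≡⟨ *-identityˡ x ⟩
        x                    ∎

      cancel′ : ∀ {w z} → w * z ≡ 1# → ∀ x → τ (z * (w * σ x)) ≡ x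
      cancel′ {w} {z} wz≡1 x = begin
        τ (z * (w * σ x))    ≡⟨ cong τ (*-assoc z w (σ x)) ⟨
        τ (z * w * σ x)      ≡⟨ cong (λ t → τ (t * σ x)) (trans (*-comm z w) wz≡1) ⟩
        τ (1# * σ x)         ≡⟨ cong τ (*-identityˡ _) ⟩
        τ (σ x)              ≡⟨ τσ x ⟩
        x                    ∎

    ψ-ψ⁻¹ : ∀ P → ψ (ψ⁻¹ P) ≡ P
    ψ-ψ⁻¹ O         = refl
    ψ-ψ⁻¹ (aff x y) = cong₂ aff (cancel u²v²≡1 x) (cancel u³v³≡1 y)

    ψ⁻¹-ψ : ∀ P → ψ⁻¹ (ψ P) ≡ P
    ψ⁻¹-ψ O         = refl
    ψ⁻¹-ψ (aff x y) = cong₂ aff (cancel′ u²v²≡1 x) (cancel′ u³v³≡1 y)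

    ψ-onCurve : ∀ P → OnCurve F E₁ P → OnCurve F E₂ (ψ P)
    ψ-onCurve O         _ = _
    ψ-onCurve (aff x y) e = trans (scale-square y) (trans (cong (λ z → u³ * u³ * σ z) e) (sym (scale-cubic x)))

    -- The equation is multiplied by the unit u⁶ and conjugated by an injective map, so it can be
    -- pulled back. Together with `ψ-ψ⁻¹` this puts the inverse image on E₁ without a computation in
    -- τ and u⁻¹.
    ψ-reflects-onCurve : ∀ P → OnCurve F E₂ (ψ P) → OnCurve F E₁ P
    ψ-reflects-onCurve O         _ = _
    ψ-reflects-onCurve (aff x y) e = σ-injective (*-cancelˡ (*-≢0 u³≢0 u³≢0)
      (trans (sym (scale-square y)) (trans e (scale-cubic x))))

    ψ⁻¹-onCurve : ∀ P → OnCurve F E₂ P → OnCurve F E₁ (ψ⁻¹ P)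
    ψ⁻¹-onCurve P e = ψ-reflects-onCurve (ψ⁻¹ P) (subst (OnCurve F E₂) (sym (ψ-ψ⁻¹ P)) e)

    private
      -- A slope has weight u: numerator and denominator scale by w u and w, where w = u² for chords
      -- and w = u³ for tangents. The denominator must be nonzero because `_⁻¹` is unspecified at 0
      -- and need not commute with σ there.
      slope : ∀ {w n d n′ d′} → ¬ (w ≡ 0#) → ¬ (d ≡ 0#) → n′ ≡ w * u * σ n → d′ ≡ w * σ d →
        n′ * d′ ⁻¹ ≡ u * σ (n * d ⁻¹)
      slope {w} {n} {d} {n′} {d′} w≢0 d≢0 n′≡ d′≡ = begin
        n′ * d′ ⁻¹                            ≡⟨ cong₂ (λ a b → a * b) n′≡ (trans (cong _⁻¹ d′≡) inverse) ⟩
        w * u * σ n * (w ⁻¹ * σ (d ⁻¹))       ≡⟨ solve 5 (λ w u n z i → w :* u :* n :* (z :* i) := w :* z :* (u :* (n :* i)))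
                                                   refl w u (σ n) (w ⁻¹) (σ (d ⁻¹)) ⟩
        w * w ⁻¹ * (u * (σ n * σ (d ⁻¹)))     ≡⟨ cong (_* (u * (σ n * σ (d ⁻¹)))) (*-inverse w w≢0) ⟩
        1# * (u * (σ n * σ (d ⁻¹)))           ≡⟨ *-identityˡ _ ⟩
        u * (σ n * σ (d ⁻¹))                  ≡⟨ cong (u *_) (σ-* n (d ⁻¹)) ⟨
        u * σ (n * d ⁻¹)                      ∎
        where
        inverse : (w * σ d) ⁻¹ ≡ w ⁻¹ * σ (d ⁻¹)
        inverse = ⁻¹-unique (*-≢0 w≢0 (σ-≢0 d≢0)) (begin
          w * σ d * (w ⁻¹ * σ (d ⁻¹))       ≡⟨ solve 4 (λ w d z i → w :* d :* (z :* i) := w :* z :* (d :* i)) refl w (σ d) (w ⁻¹) (σ (d ⁻¹)) ⟩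
          w * w ⁻¹ * (σ d * σ (d ⁻¹))       ≡⟨ cong₂ _*_ (*-inverse w w≢0) (trans (sym (σ-* d (d ⁻¹))) (trans (cong σ (*-inverse d d≢0)) σ-1)) ⟩
          1# * 1#                           ≡⟨ *-identityˡ 1# ⟩
          1#                                ∎)

      ψ-chord : ∀ l x₁ y₁ x₂ → chord (u * σ l) (u² * σ x₁) (u³ * σ y₁) (u² * σ x₂) ≡ ψ (chord l x₁ y₁ x₂)
      ψ-chord l x₁ y₁ x₂ = cong₂ aff
        (begin
          u * σ l * (u * σ l) - u² * σ x₁ - u² * σ x₂
            ≡⟨ solve 4 (λ u l a b → u :* l :* (u :* l) :- u :* u :* a :- u :* u :* b := u :* u :* (l :* l :- a :- b)) refl u (σ l) (σ x₁) (σ x₂) ⟩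
          u² * (σ l * σ l - σ x₁ - σ x₂)
            ≡⟨ cong (u² *_) σ-x₃ ⟨
          u² * σ (l * l - x₁ - x₂) ∎)
        (begin
          u * σ l * (u² * σ x₁ - (u * σ l * (u * σ l) - u² * σ x₁ - u² * σ x₂)) - u³ * σ y₁
            ≡⟨ solve 5 (λ u l a b y → u :* l :* (u :* u :* a :- (u :* l :* (u :* l) :- u :* u :* a :- u :* u :* b)) :- u :* u :* u :* y
                 := u :* u :* u :* (l :* (a :- (l :* l :- a :- b)) :- y)) refl u (σ l) (σ x₁) (σ x₂) (σ y₁) ⟩
          u³ * (σ l * (σ x₁ - (σ l * σ l - σ x₁ - σ x₂)) - σ y₁)
            ≡⟨ cong (u³ *_) (trans (σ-sub _ _) (cong (_- σ y₁) (trans (σ-* _ _)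
                 (cong (σ l *_) (trans (σ-sub _ _) (cong (λ z → σ x₁ - z) σ-x₃)))))) ⟨
          u³ * σ (l * (x₁ - (l * l - x₁ - x₂)) - y₁) ∎)
        where
        σ-x₃ : σ (l * l - x₁ - x₂) ≡ σ l * σ l - σ x₁ - σ x₂
        σ-x₃ = trans (σ-sub _ _) (cong (_- σ x₂) (trans (σ-sub _ _) (cong (_- σ x₁) (σ-* l l))))

    -- The curve equations exclude the junk slope at 2y = 0: equal abscissae force y₁ = ± y₂.
    ψ-addPt : ∀ P Q → OnCurve F E₁ P → OnCurve F E₁ Q → addPt F E₂ (ψ P) (ψ Q) ≡ ψ (addPt F E₁ P Q)
    ψ-addPt O           Q           _ _ = refl
    ψ-addPt (aff x₁ y₁) O           _ _ = refl
    ψ-addPt (aff x₁ y₁) (aff x₂ y₂) e₁ e₂ with x₁ ≟ x₂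
    ... | no x₁≢x₂ = begin
      addPt F E₂ (ψ (aff x₁ y₁)) (ψ (aff x₂ y₂))
        ≡⟨ addPt-chord E₂ (x₁≢x₂ ∘ σ-injective ∘ *-cancelˡ u²≢0) ⟩
      chord ((u³ * σ y₂ - u³ * σ y₁) * (u² * σ x₂ - u² * σ x₁) ⁻¹) (u² * σ x₁) (u³ * σ y₁) (u² * σ x₂)
        ≡⟨ cong (λ l → chord l (u² * σ x₁) (u³ * σ y₁) (u² * σ x₂))
             (slope u²≢0 (x₁≢x₂ ∘ sym ∘ x-y≡0⇒x≡y) (σ-difference u³ y₂ y₁) (σ-difference u² x₂ x₁)) ⟩
      chord (u * σ ((y₂ - y₁) * (x₂ - x₁) ⁻¹)) (u² * σ x₁) (u³ * σ y₁) (u² * σ x₂)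
        ≡⟨ ψ-chord _ x₁ y₁ x₂ ⟩
      ψ (chord ((y₂ - y₁) * (x₂ - x₁) ⁻¹) x₁ y₁ x₂) ∎
      where
      σ-difference : ∀ w x y → w * σ x - w * σ y ≡ w * σ (x - y)
      σ-difference w x y = trans (solve 3 (λ w x y → w :* x :- w :* y := w :* (x :- y)) refl w (σ x) (σ y))
        (cong (w *_) (sym (σ-sub x y)))
    ... | yes x₁≡x₂ with y₁ + y₂ ≟ 0#
    ...   | yes y₁+y₂≡0 = addPt-opposite E₂ (cong (λ x → u² * σ x) x₁≡x₂)
              (trans (sym (distribˡ u³ _ _)) (trans (cong (u³ *_) (trans (sym (σ-+ y₁ y₂)) (trans (cong σ y₁+y₂≡0) σ-0))) (zeroʳ u³)))
    ...   | no y₁+y₂≢0 = begin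
      addPt F E₂ (ψ (aff x₁ y₁)) (ψ (aff x₂ y₂))
        ≡⟨ addPt-tangent E₂ (cong (λ x → u² * σ x) x₁≡x₂) (λ e → σ-≢0 y₁+y₂≢0
             (*-cancelˡ u³≢0 (trans (cong (u³ *_) (σ-+ y₁ y₂)) (trans (distribˡ u³ _ _) (trans e (sym (zeroʳ u³))))))) ⟩
      chord ((fromℕ 3 * (u² * σ x₁ * (u² * σ x₁)) + Curve.A E₂) * (fromℕ 2 * (u³ * σ y₁)) ⁻¹) (u² * σ x₁) (u³ * σ y₁) (u² * σ x₂)
        ≡⟨ cong (λ l → chord l (u² * σ x₁) (u³ * σ y₁) (u² * σ x₂)) (slope u³≢0 2y₁≢0 numerator denominator) ⟩
      chord (u * σ ((fromℕ 3 * (x₁ * x₁) + A₁) * (fromℕ 2 * y₁) ⁻¹)) (u² * σ x₁) (u³ * σ y₁) (u² * σ x₂)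
        ≡⟨ ψ-chord _ x₁ y₁ x₂ ⟩
      ψ (chord ((fromℕ 3 * (x₁ * x₁) + A₁) * (fromℕ 2 * y₁) ⁻¹) x₁ y₁ x₂) ∎
      where
      y₁≡y₂ : y₁ ≡ y₂
      y₁≡y₂ with x²≡y²⇒x≡±y {y₁} {y₂} (trans e₁ (trans (cong (λ x → x * x * x + A₁ * x + B₁) x₁≡x₂) (sym e₂)))
      ... | inj₁ e = e
      ... | inj₂ e = contradiction (trans (cong (_+ y₂) e) (-‿inverseˡ y₂)) y₁+y₂≢0
      2y₁≢0 : ¬ (fromℕ 2 * y₁ ≡ 0#)
      2y₁≢0 e = y₁+y₂≢0 (trans (cong (y₁ +_) (sym y₁≡y₂))
        (trans (solve 1 (λ y → y :+ y := con (ℤ.+ 2) :* y) refl y₁) e))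
      numerator : fromℕ 3 * (u² * σ x₁ * (u² * σ x₁)) + Curve.A E₂ ≡ u³ * u * σ (fromℕ 3 * (x₁ * x₁) + A₁)
      numerator = begin
        fromℕ 3 * (u² * σ x₁ * (u² * σ x₁)) + Curve.A E₂
          ≡⟨ cong (fromℕ 3 * (u² * σ x₁ * (u² * σ x₁)) +_) A₂≡ ⟩
        fromℕ 3 * (u² * σ x₁ * (u² * σ x₁)) + u² * u² * σ A₁
          ≡⟨ solve 3 (λ u x A → con (ℤ.+ 3) :* (u :* u :* x :* (u :* u :* x)) :+ u :* u :* (u :* u) :* A
               := u :* u :* u :* u :* (con (ℤ.+ 3) :* (x :* x) :+ A)) refl u (σ x₁) (σ A₁) ⟩
        u³ * u * (fromℕ 3 * (σ x₁ * σ x₁) + σ A₁)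
          ≡⟨ cong (u³ * u *_) (trans (σ-+ _ _) (cong (_+ σ A₁) (trans (σ-* _ _) (cong₂ _*_ (σ-fromℕ 3) (σ-* x₁ x₁))))) ⟨
        u³ * u * σ (fromℕ 3 * (x₁ * x₁) + A₁) ∎
      denominator : fromℕ 2 * (u³ * σ y₁) ≡ u³ * σ (fromℕ 2 * y₁)
      denominator = trans (solve 3 (λ t w y → t :* (w :* y) := w :* (t :* y)) refl (fromℕ 2) u³ (σ y₁))
        (cong (u³ *_) (sym (trans (σ-* _ _) (cong (_* σ y₁) (σ-fromℕ 2)))))

    groupIso : GroupIso F E₁ E₂
    groupIso = mk↔ₛ′ (λ (P , e) → ψ P , ψ-onCurve P e) (λ (P , e) → ψ⁻¹ P , ψ⁻¹-onCurve P e)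
        (λ (P , _) → point-≡ E₂ (ψ-ψ⁻¹ P)) (λ (P , _) → point-≡ E₁ (ψ⁻¹-ψ P))
      , λ (P , e₁) (Q , e₂) R R≡ → trans (cong ψ R≡) (sym (ψ-addPt P Q e₁ e₂))
      where
      onCurve-irrelevant : ∀ E P (e e′ : OnCurve F E P) → e ≡ e′
      onCurve-irrelevant E O         _ _  = refl
      onCurve-irrelevant E (aff _ _) e e′ = ≡-irrelevant e e′
      point-≡ : ∀ E {P Q : Point F E} → proj₁ P ≡ proj₁ Q → P ≡ Q
      point-≡ E {P , e} {P , e′} refl = cong (P ,_) (onCurve-irrelevant E P e e′)

  -- The type of points has `pointCount` elements.

  Σ-Fin : ∀ {n} (f : Fin n → ℕ) → Σ (Fin n) (Fin ∘ f) ↔ Fin (ℕsum f)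
  Σ-Fin {zero}  f = mk↔ₛ′ (λ ()) (λ ()) (λ ()) (λ ())
  Σ-Fin {suc n} f = ↔-sym Finₚ.+↔⊎ ↔-∘ ((↔-id _ ⊎-↔ Σ-Fin (f ∘ Fin.suc)) ↔-∘ uncons)
    where
    uncons : Σ (Fin (suc n)) (Fin ∘ f) ↔ (Fin (f Fin.zero) ⊎ Σ (Fin n) (Fin ∘ f ∘ Fin.suc))
    uncons = mk↔ₛ′ (λ where (Fin.zero , x) → inj₁ x ; (Fin.suc i , x) → inj₂ (i , x))
      (λ where (inj₁ x) → Fin.zero , x ; (inj₂ (i , x)) → Fin.suc i , x)
      (λ where (inj₁ _) → refl ; (inj₂ _) → refl)
      (λ where (Fin.zero , _) → refl ; (Fin.suc _ , _) → refl)

  -- Identity proofs being unique, the curve equation at a pair of coordinates is a type with at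
  -- most one element, counted by its indicator. `Σ-Fin` then assembles these into the double sum of
  -- `pointCount`.
  ≡↔Fin-𝟙 : ∀ {x y : Carrier} (d : Dec (x ≡ y)) → (x ≡ y) ↔ Fin (𝟙 d)
  ≡↔Fin-𝟙 (yes e) = mk↔ₛ′ (λ _ → Fin.zero) (λ _ → e) (λ where Fin.zero → refl ; (Fin.suc ())) (λ e′ → ≡-irrelevant e e′)
  ≡↔Fin-𝟙 (no ¬e) = mk↔ₛ′ (λ e → contradiction e ¬e) (λ ()) (λ ()) (λ e → contradiction e ¬e)

  Point↔Fin : ∀ E → Point F E ↔ Fin (pointCount F E)
  Point↔Fin E = subst (λ k → Point F E ↔ Fin k) (sym count≡)
    (↔-sym Finₚ.+↔⊎ ↔-∘ ((↔-sym Finₚ.1↔⊤ ⊎-↔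
      (Σ-Fin (λ i → ℕsum (λ j → ind i j)) ↔-∘
        Σ-↔ (↔-id _) (λ {i} → Σ-Fin (ind i) ↔-∘ Σ-↔ (↔-id _) (λ {j} → ≡↔Fin-𝟙 (on-curve? i j))))) ↔-∘ coordinates))
    where
    ind : Fin q → Fin q → ℕ
    ind i j = indicator F E (fromFin i) (fromFin j)
    on-curve? : ∀ i j → Dec (OnCurve F E (aff (fromFin i) (fromFin j)))
    on-curve? i j = fromFin j * fromFin j ≟ fromFin i * fromFin i * fromFin i + Curve.A E * fromFin i + Curve.B E
    count≡ : pointCount F E ≡ suc (ℕsum (λ i → ℕsum (ind i)))
    count≡ = cong suc (trans (sumFin≡ℕsum F q _) (#F-cong (λ x → sumFin≡ℕsum F q (λ j → indicator F E x (fromFin j)))))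
    Affine : Set
    Affine = Σ (Fin q) λ i → Σ (Fin q) λ j → OnCurve F E (aff (fromFin i) (fromFin j))
    coordinates : Point F E ↔ (⊤ ⊎ Affine)
    coordinates = mk↔ₛ′ to from to-from from-to
      where
      to : Point F E → ⊤ ⊎ Affine
      to (O , _)       = inj₁ tt
      to (aff x y , e) = inj₂ (toFin x , toFin y ,
        subst₂ (λ x y → OnCurve F E (aff x y)) (sym (fromFin-toFin x)) (sym (fromFin-toFin y)) e)
      from : ⊤ ⊎ Affine → Point F E
      from (inj₁ _)           = O , tt
      from (inj₂ (i , j , e)) = aff (fromFin i) (fromFin j) , e
      affine-≡ : ∀ {i j i′ j′ e e′} → i ≡ i′ → j ≡ j′ → _≡_ {A = Affine} (i , j , e) (i′ , j′ , e′)
      affine-≡ {i} {j} {e = e} {e′} refl refl = cong (λ e → i , j , e) (≡-irrelevant e e′)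
      aff-≡ : ∀ {x y x′ y′ e e′} → x ≡ x′ → y ≡ y′ → _≡_ {A = Point F E} (aff x y , e) (aff x′ y′ , e′)
      aff-≡ {x} {y} {e = e} {e′} refl refl = cong (aff x y ,_) (≡-irrelevant e e′)
      to-from : ∀ P → to (from P) ≡ P
      to-from (inj₁ _)           = refl
      to-from (inj₂ (i , j , _)) = cong inj₂ (affine-≡ (toFin-fromFin i) (toFin-fromFin j))
      from-to : ∀ P → from (to P) ≡ P
      from-to (O , _)       = refl
      from-to (aff x y , _) = aff-≡ (fromFin-toFin x) (fromFin-toFin y)

  groupIso⇒pointCount≡ : ∀ {E₁ E₂} → GroupIso F E₁ E₂ → pointCount F E₁ ≡ pointCount F E₂
  groupIso⇒pointCount≡ {E₁} {E₂} (φ , _) =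
    Perm.↔⇒≡ (Point↔Fin E₂ ↔-∘ (φ ↔-∘ ↔-sym (Point↔Fin E₁)))

-- Arithmetic modulo 4 of primes and their even powers.

-- Written with sums so that q ≡ suc (4* n) is by definition the `order` assumption of
-- `CountingTheory`.
4*_ : ℕ → ℕ
4* k = (k ℕ.+ k) ℕ.+ (k ℕ.+ k)

4*≡*4 : ∀ k → 4* k ≡ k ℕ.* 4
4*≡*4 = solve 1 (λ k → (k :+ k) :+ (k :+ k) := k :* con 4) refl
  where open +-*-Solver

4*-%4 : ∀ k c → (4* k ℕ.+ c) % 4 ≡ c % 4
4*-%4 k c = trans (cong (_% 4) (trans (ℕₚ.+-comm (4* k) c) (cong (c ℕ.+_) (4*≡*4 k)))) ([m+kn]%n≡m%n c k 4)

4*-injective : ∀ {k l} → 4* k ≡ 4* l → k ≡ l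
4*-injective {k} {l} e = ℕₚ.*-cancelʳ-≡ k l 4 (trans (sym (4*≡*4 k)) (trans e (4*≡*4 l)))

-- p (4k + 1) = 4kp + p with p = 4h + 1: passing to the next power of p appends the digit h to the
-- quarter.
4*-digit : ∀ {p h} k → p ≡ suc (4* h) → p ℕ.* suc (4* k) ≡ suc (4* (k ℕ.* p ℕ.+ h))
4*-digit {h = h} k refl = solve 2 (λ h k →
    let p = con 1 :+ ((h :+ h) :+ (h :+ h)) ; l = k :* p :+ h
    in p :* (con 1 :+ ((k :+ k) :+ (k :+ k))) := con 1 :+ ((l :+ l) :+ (l :+ l))) refl h k
  where open +-*-Solver

prime∣^ : ∀ {p} → Prime p → ∀ m k → p ∣ m ^ suc k → p ∣ m
prime∣^ p-prime m k p∣ with euclidsLemma m (m ^ k) p-prime p∣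
... | inj₁ p∣m = p∣m
prime∣^ p-prime m zero    p∣ | inj₂ p∣1 = ∣-trans p∣1 (divides m (sym (ℕₚ.*-identityʳ m)))
prime∣^ p-prime m (suc k) p∣ | inj₂ p∣m^k = prime∣^ p-prime m k p∣m^k

prime-mod4 : ∀ {p} → Prime p → 3 < p → (∃ λ h → p ≡ suc (4* h)) ⊎ (∃ λ h → p ≡ suc (suc (suc (4* h))))
prime-mod4 {p} p-prime 3<p = by-residue (p % 4) (m%n<n p 4)
  (trans (m≡m%n+[m/n]*n p 4) (cong (p % 4 ℕ.+_) (sym (4*≡*4 h))))
  where
  h : ℕ
  h = p ℕ./ 4
  2∤p : ¬ (2 ∣ p)
  2∤p 2∣p with prime⇒irreducible p-prime 2∣p
  ... | inj₁ ()
  ... | inj₂ 2≡p = contradiction (subst (3 <_) (sym 2≡p) 3<p) λ where (s≤s (s≤s ()))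
  by-residue : ∀ c → c < 4 → p ≡ c ℕ.+ 4* h → (∃ λ h → p ≡ suc (4* h)) ⊎ (∃ λ h → p ≡ suc (suc (suc (4* h))))
  by-residue 0 _ e = contradiction (divides (h ℕ.+ h) (trans e
    (solve 1 (λ h → (h :+ h) :+ (h :+ h) := (h :+ h) :* con 2) refl h))) 2∤p
    where open +-*-Solver
  by-residue 1 _ e = inj₁ (h , e)
  by-residue 2 _ e = contradiction (divides (suc (h ℕ.+ h)) (trans e
    (solve 1 (λ h → con 2 :+ ((h :+ h) :+ (h :+ h)) := (con 1 :+ (h :+ h)) :* con 2) refl h))) 2∤p
    where open +-*-Solver
  by-residue 3 _ e = inj₂ (h , e)
  by-residue (suc (suc (suc (suc _)))) (s≤s (s≤s (s≤s (s≤s ())))) _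

odd-square^ : ∀ j k → ∃ λ n → suc (j ℕ.+ j) ^ (k ℕ.* 2) ≡ suc (4* n)
odd-square^ j zero = 0 , refl
odd-square^ j (suc k) =
  let n , e = odd-square^ j k
  -- The witness comes from (2j + 1)² = 4(j² + j) + 1, multiplied by 4n + 1.
  in (j ℕ.* j ℕ.+ j) ℕ.* suc (4* n) ℕ.+ n , trans (cong (λ z → suc (j ℕ.+ j) ℕ.* (suc (j ℕ.+ j) ℕ.* z)) e)
    (solve 2 (λ j n → let p = con 1 :+ (j :+ j) ; 4n+1 = con 1 :+ ((n :+ n) :+ (n :+ n)) ; k = (j :* j :+ j) :* 4n+1 :+ n
      in p :* (p :* 4n+1) := con 1 :+ ((k :+ k) :+ (k :+ k))) refl j n)
  where open +-*-Solver

even-power : ∀ {p r} → Prime p → 3 < p → 2 ∣ r → ∃ λ n → p ^ r ≡ suc (4* n)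
even-power p-prime 3<p (divides k refl) with prime-mod4 p-prime 3<p
... | inj₁ (h , refl) = odd-square^ (h ℕ.+ h) k
... | inj₂ (h , refl) =
  let n , e = odd-square^ (suc (h ℕ.+ h)) k
  in n , trans (cong (λ z → suc (suc z) ^ (k ℕ.* 2)) (sym (ℕₚ.+-suc (h ℕ.+ h) (h ℕ.+ h)))) e

-- The cofactor p^(r-1) is the exponent of the inverse Frobenius.
power-factor : ∀ p r → ¬ (p ^ r ≡ 1) → ∃ λ e → e ℕ.* p ≡ p ^ r
power-factor p zero    p^0≢1 = contradiction refl p^0≢1
power-factor p (suc r) _     = p ^ r , ℕₚ.*-comm (p ^ r) p

-- Curves with j = 1728 over a field of order p^r = 4n + 1.

module J1728Theory {p′ : ℕ} (r n : ℕ) (p-prime : Prime (suc p′)) (3<p : 3 < suc p′)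
  (F : FiniteField (suc p′ ^ r)) (order : suc p′ ^ r ≡ suc (4* n)) where

  open CountingTheory F n order

  p : ℕ
  p = suc p′

  -- `FiniteField` records only the order. Since p^r vanishes in F and there are no zero divisors, p
  -- vanishes too.
  characteristic : fromℕ p ≡ 0#
  characteristic with fromℕ p ≟ 0#
  ... | yes e = e
  ... | no ≢0 = contradiction (trans (sym (fromℕ-^ p r)) fromℕ-order) (^-≢0 r ≢0)

  open CharacteristicTheory F p-prime characteristic
  open IsomorphismTheory F

  p∤small : ∀ {k} → 0 < k → k ℕ.≤ 3 → ¬ (p ∣ k)
  p∤small {suc k} _ k≤3 p∣k = ℕₚ.<⇒≱ 3<p (ℕₚ.≤-trans (∣⇒≤ p∣k) k≤3)

  p∤2 : ¬ (p ∣ 2)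
  p∤2 = p∤small (s≤s z≤n) (s≤s (s≤s z≤n))

  p∤3 : ¬ (p ∣ 3)
  p∤3 = p∤small (s≤s z≤n) (s≤s (s≤s (s≤s z≤n)))

  1728≢0 : ¬ (fromℕ 1728 ≡ 0#)
  -- 1728 = 2^6 · 3^3, and p > 3 divides neither factor.
  1728≢0 e with euclidsLemma (2 ^ 6) (3 ^ 3) p-prime (fromℕ≡0⇒p∣ 1728 e)
  ... | inj₁ p∣2^6 = p∤2 (prime∣^ p-prime 2 5 p∣2^6)
  ... | inj₂ p∣3^3 = p∤3 (prime∣^ p-prime 3 2 p∣3^3)

  27≢0 : ¬ (fromℕ 27 ≡ 0#)
  27≢0 e = p∤3 (prime∣^ p-prime 3 2 (fromℕ≡0⇒p∣ 27 e))

  c*a/[a+b]≡c⇒b≡0 : ∀ {c a b} → ¬ (c ≡ 0#) → ¬ (a + b ≡ 0#) → c * a * (a + b) ⁻¹ ≡ c → b ≡ 0#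
  c*a/[a+b]≡c⇒b≡0 {c} {a} {b} c≢0 a+b≢0 e = +-cancelˡ a b 0# (*-cancelˡ c≢0 (begin
    c * (a + b)                          ≡⟨ cong (_* (a + b)) e ⟨
    c * a * (a + b) ⁻¹ * (a + b)         ≡⟨ *-assoc (c * a) _ _ ⟩
    c * a * ((a + b) ⁻¹ * (a + b))       ≡⟨ cong (c * a *_) (trans (*-comm _ _) (*-inverse _ a+b≢0)) ⟩
    c * a * 1#                           ≡⟨ *-identityʳ _ ⟩
    c * a                                ≡⟨ cong (c *_) (+-identityʳ a) ⟨
    c * (a + 0#)                         ∎))
    where open ≡-Reasoning

  j≡1728⇒B≡0 : ∀ (E : Curve F) → jInvariant F E ≡ fromℕ 1728 → Curve.B E ≡ 0#
  j≡1728⇒B≡0 (curve A B nonsingular) j≡ with integral (c*a/[a+b]≡c⇒b≡0 1728≢0 nonsingular j≡)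
  ... | inj₁ e = contradiction e 27≢0
  ... | inj₂ e = [ id , id ]′ (integral e)

  B≡0⇒A≢0 : ∀ (E : Curve F) → Curve.B E ≡ 0# → ¬ (Curve.A E ≡ 0#)
  B≡0⇒A≢0 (curve _ _ nonsingular) refl refl = nonsingular
    (solve 2 (λ x y → x :* (zero# :* zero# :* zero#) :+ y :* (zero# :* zero#) := zero#) refl (fromℕ 4) (fromℕ 27))
    where zero# = con (ℤ.+ 0)

  -- Affine counts leave out `O`: the residues are 3 here and 1 for nonsquares, where those of the
  -- full count are 0 and 2.
  affineCount-square : ∀ {a} → ¬ (a ≡ 0#) → Square (- a) → affineCount a % 4 ≡ 3
  affineCount-square {a} a≢0 sq =
    let k , e = affineCount-mod4 a
    in trans (cong (_% 4) (trans e (cong (4* k ℕ.+_) (#roots-square a≢0 sq)))) (4*-%4 k 3)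

  affineCount-nonsquare : ∀ {a} → ¬ Square (- a) → affineCount a % 4 ≡ 1
  affineCount-nonsquare {a} ¬sq =
    let k , e = affineCount-mod4 a
    in trans (cong (_% 4) (trans e (cong (4* k ℕ.+_) (#roots-nonsquare ¬sq)))) (4*-%4 k 1)

  order%4 : (p ^ r) % 4 ≡ 1
  order%4 = trans (cong (_% 4) (trans order (ℕₚ.+-comm 1 (4* n)))) (4*-%4 n 1)

  square-neg : ∀ {a} → Square a → Square (- a)
  square-neg {a} sq = subst Square (trans (sym (-‿distribˡ-* 1# a)) (cong -_ (*-identityˡ a))) (square-* -1-square sq)

  quarter-power : ∀ {h} → p ≡ suc (4* h) → ∀ k → p ^ k ≡ suc (4* (quarter h k))
  quarter-power {h} p≡ zero    = refl
  quarter-power {h} p≡ (suc k) = trans (cong (p ℕ.*_) (quarter-power p≡ k)) (4*-digit (quarter h k) p≡)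

  ordinary : ∀ {h a} → p ≡ suc (4* h) → ¬ (a ≡ 0#) → ¬ (p ∣ affineCount a)
  ordinary {h} {a} p≡ a≢0 (divides k e) = *-≢0 C≢0 (^-≢0 n a≢0) (begin
    fromℕ (m C n) * a ^ᶠ n                ≡⟨ -‿involutive _ ⟨
    - - (fromℕ (m C n) * a ^ᶠ n)          ≡⟨ cong -_ (fromℕ-affineCount a) ⟨
    - fromℕ (affineCount a)               ≡⟨ cong (-_ ∘ fromℕ) e ⟩
    - fromℕ (k ℕ.* p)                     ≡⟨ cong -_ (fromℕ-multiple k) ⟩
    - 0#                                  ≡⟨ -0#≈0# ⟩
    0#                                    ∎)
    where
    open ≡-Reasoning
    -- Both `order` and `quarter-power` write p^r as one more than a multiple of 4, which identifies
    -- n as the number whose r base-p digits all equal h.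
    n≡ : quarter h r ≡ n
    n≡ = 4*-injective (ℕₚ.suc-injective (trans (sym (quarter-power p≡ r)) order))
    2h<p : h ℕ.+ h < p
    2h<p = subst (h ℕ.+ h <_) (sym p≡) (s≤s (ℕₚ.m≤m+n (h ℕ.+ h) (h ℕ.+ h)))
    C≢0 : ¬ (fromℕ (m C n) ≡ 0#)
    C≢0 = subst (λ n → ¬ (fromℕ ((n ℕ.+ n) C n) ≡ 0#)) n≡ (quarter-C≢0 h 2h<p r)

  nonsquare-^ : ∀ {a} → ¬ Square a → ∀ k → ¬ Square (a ^ᶠ suc (k ℕ.+ k))
  nonsquare-^ {a} ¬sq k sq = ¬sq (square-cancel (^-≢0 (k ℕ.+ k) a≢0) (a ^ᶠ k , sym (^-homo-* a k k)) sq)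
    where
    a≢0 : ¬ (a ≡ 0#)
    a≢0 = nonsquare⇒≢0 ¬sq

  fermat-all : ∀ x → x ^ᶠ (p ^ r) ≡ x
  fermat-all x with x ≟ 0#
  ... | no x≢0   = fermat x≢0
  ... | yes refl = trans (cong (0# ^ᶠ_) order) (zeroˡ _)

  B-scale : ∀ (E₁ E₂ : Curve F) → Curve.B E₁ ≡ 0# → Curve.B E₂ ≡ 0# → ∀ {w} (σ : Carrier → Carrier) → σ 0# ≡ 0# →
    Curve.B E₂ ≡ w * σ (Curve.B E₁)
  B-scale (curve _ _ _) (curve _ _ _) refl refl {w} σ σ0≡0 = sym (trans (cong (w *_) σ0≡0) (zeroʳ w))

  scaling-iso : ∀ {E₁ E₂ : Curve F} → Curve.B E₁ ≡ 0# → Curve.B E₂ ≡ 0# → ∀ {u} → ¬ (u ≡ 0#) →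
    Curve.A E₂ ≡ u * u * (u * u) * Curve.A E₁ → GroupIso F E₁ E₂
  scaling-iso {E₁} {E₂} B₁≡0 B₂≡0 {u} u≢0 A₂≡ =
    SemilinearIsomorphism.groupIso id id (λ _ _ → refl) (λ _ _ → refl) refl (λ _ → refl) (λ _ → refl)
      u u≢0 E₁ E₂ A₂≡ (B-scale E₁ E₂ B₁≡0 B₂≡0 id refl)

  frobenius-iso : ∀ {E₁ E₂ : Curve F} → Curve.B E₁ ≡ 0# → Curve.B E₂ ≡ 0# → ∀ {u} → ¬ (u ≡ 0#) →
    Curve.A E₂ ≡ u * u * (u * u) * Curve.A E₁ ^ᶠ p → GroupIso F E₁ E₂
  frobenius-iso {E₁} {E₂} B₁≡0 B₂≡0 {u} u≢0 A₂≡ =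
    SemilinearIsomorphism.groupIso (_^ᶠ p) (_^ᶠ e) frobenius-+ (λ x y → ^-distrib-* x y p) (1^ p)
      (λ x → trans (^-assocʳ x e p) (trans (cong (x ^ᶠ_) e*p≡) (fermat-all x)))
      (λ x → trans (^-assocʳ x p e) (trans (cong (x ^ᶠ_) (trans (ℕₚ.*-comm p e) e*p≡)) (fermat-all x)))
      u u≢0 E₁ E₂ A₂≡ (B-scale E₁ E₂ B₁≡0 B₂≡0 (_^ᶠ p) (zeroˡ _))
    where
    -- This rules out r = 0, where p^r has no factor p to split off.
    p^r≢1 : ¬ (p ^ r ≡ 1)
    p^r≢1 e = n≢0 (4*-injective (ℕₚ.suc-injective (trans (sym order) e)))
    e = proj₁ (power-factor p r p^r≢1)
    e*p≡ = proj₂ (power-factor p r p^r≢1)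

  pointCount≡⇒affineCount≡ : ∀ (E₁ E₂ : Curve F) → Curve.B E₁ ≡ 0# → Curve.B E₂ ≡ 0# →
    pointCount F E₁ ≡ pointCount F E₂ → affineCount (Curve.A E₁) ≡ affineCount (Curve.A E₂)
  pointCount≡⇒affineCount≡ E₁ E₂ B₁≡0 B₂≡0 e =
    ℕₚ.suc-injective (trans (sym (pointCount≡ E₁ B₁≡0)) (trans e (pointCount≡ E₂ B₂≡0)))

  private
    3≢1 : ∀ {k} → k % 4 ≡ 3 → ¬ (k % 4 ≡ 1)
    3≢1 e e′ with trans (sym e) e′
    ... | ()

  -- Multiplication by the nonsquare t moves -a to the other square class, so of the two counts one
  -- is 3 and the other 1 modulo 4.
  nonsquare-ratio : ∀ {a t} → ¬ (a ≡ 0#) → ¬ Square t → ¬ (affineCount a ≡ affineCount (t * a))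
  nonsquare-ratio {a} {t} a≢0 ¬sq-t e with square? (- a)
  ... | yes sq = 3≢1 {affineCount a} (affineCount-square a≢0 sq) (trans (cong (_% 4) e)
          (affineCount-nonsquare (¬sq-t ∘ square-cancel -a≢0 sq ∘ subst Square (-‿distribʳ-* t a))))
    where
    -a≢0 : ¬ (- a ≡ 0#)
    -a≢0 -a≡0 = a≢0 (trans (sym (-‿involutive a)) (trans (cong -_ -a≡0) -0#≈0#))
  ... | no ¬sq = 3≢1 {affineCount (t * a)}
          (affineCount-square (*-≢0 t≢0 a≢0) (subst Square (sym (-‿distribʳ-* t a)) (nonsquare-* ¬sq ¬sq-t)))
          (trans (cong (_% 4) (sym e)) (affineCount-nonsquare ¬sq))
    where
    t≢0 : ¬ (t ≡ 0#)
    t≢0 = nonsquare⇒≢0 ¬sq-t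

  -- Twist counts add up to 2q, so equal ones are both q ≡ 1 modulo 4. For a square a, also -a is a
  -- square and the count would be 3.
  quadratic-twist-nonsquare : ∀ {a d} → ¬ (a ≡ 0#) → ¬ Square d →
    affineCount a ≡ affineCount (d * d * a) → ¬ Square a
  quadratic-twist-nonsquare {a} {d} a≢0 ¬sq-d e sq =
    3≢1 {affineCount a} (affineCount-square a≢0 (square-neg sq)) (trans (cong (_% 4) count≡order) order%4)
    where
    count≡order : affineCount a ≡ p ^ r
    count≡order = ℕₚ.*-cancelˡ-≡ (affineCount a) (p ^ r) 2 (begin
      affineCount a ℕ.+ (affineCount a ℕ.+ 0)    ≡⟨ cong (affineCount a ℕ.+_) (trans (ℕₚ.+-identityʳ _) e) ⟩
      affineCount a ℕ.+ affineCount (d * d * a)  ≡⟨ affineCount-twist ¬sq-d a ⟩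
      p ^ r ℕ.+ p ^ r                            ≡⟨ cong (p ^ r ℕ.+_) (ℕₚ.+-identityʳ (p ^ r)) ⟨
      p ^ r ℕ.+ (p ^ r ℕ.+ 0)                    ∎)
      where open ≡-Reasoning

  -- For p ≡ 3 mod 4 and a, d nonsquare, a^p and d²a lie in the same class modulo fourth powers.
  twist-fourth-power : ∀ {h a d} → p ≡ suc (suc (suc (4* h))) → ¬ Square a → ¬ Square d →
    ∃ λ u → ¬ (u ≡ 0#) × d * d * a ≡ u * u * (u * u) * a ^ᶠ p
  twist-fourth-power {h} {a} {d} p≡ ¬sq-a ¬sq-d = y * s ⁻¹ , u≢0 , (begin
    d * d * a                                    ≡⟨ cong (λ z → z * z * a) u²s≡d ⟨
    (u * u * s) * (u * u * s) * a                ≡⟨ solve 3 (λ u s a → (u :* u :* s) :* (u :* u :* s) :* a := u :* u :* (u :* u) :* (a :* (s :* s))) refl u s a ⟩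
    u * u * (u * u) * (a * (s * s))              ≡⟨ cong (λ z → u * u * (u * u) * (a * z)) (^-homo-* a e e) ⟨
    u * u * (u * u) * a ^ᶠ suc (e ℕ.+ e)         ≡⟨ cong (λ k → u * u * (u * u) * a ^ᶠ k) exponent ⟩
    u * u * (u * u) * a ^ᶠ p                     ∎)
    where
    open ≡-Reasoning
    e : ℕ
    -- This is (p - 1)/2, which is odd because p ≡ 3 modulo 4. Hence s = a^e is a nonsquare, and a^p
    -- = a s².
    e = suc (h ℕ.+ h)
    exponent : suc (e ℕ.+ e) ≡ p
    exponent = trans (cong (suc ∘ suc) (ℕₚ.+-suc (h ℕ.+ h) (h ℕ.+ h))) (sym p≡)
    s : Carrier
    s = a ^ᶠ e
    ¬sq-s : ¬ Square s
    ¬sq-s = nonsquare-^ ¬sq-a h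
    s≢0 : ¬ (s ≡ 0#)
    s≢0 = nonsquare⇒≢0 ¬sq-s
    d≢0 : ¬ (d ≡ 0#)
    d≢0 = nonsquare⇒≢0 ¬sq-d
    sq : Square (d * s)
    sq = nonsquare-* ¬sq-s ¬sq-d
    y u : Carrier
    y = proj₁ sq
    -- With y² = d s the quotient u = y/s satisfies u² s = d, and therefore d² a = u⁴ s² a = u⁴ a^p.
    u = y * s ⁻¹
    u²s≡d : u * u * s ≡ d
    u²s≡d = begin
      (y * s ⁻¹) * (y * s ⁻¹) * s          ≡⟨ solve 3 (λ y s i → (y :* i) :* (y :* i) :* s := (y :* y) :* i :* (s :* i)) refl y s (s ⁻¹) ⟩
      y * y * s ⁻¹ * (s * s ⁻¹)            ≡⟨ cong₂ (λ z w → z * s ⁻¹ * w) (proj₂ sq) (*-inverse s s≢0) ⟩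
      d * s * s ⁻¹ * 1#                    ≡⟨ trans (*-identityʳ _) (*-assoc d s (s ⁻¹)) ⟩
      d * (s * s ⁻¹)                       ≡⟨ trans (cong (d *_) (*-inverse s s≢0)) (*-identityʳ d) ⟩
      d                                    ∎
    u≢0 : ¬ (u ≡ 0#)
    u≢0 u≡0 = d≢0 (trans (sym u²s≡d) (trans (cong (λ z → z * z * s) u≡0) (trans (cong (_* s) (zeroˡ _)) (zeroˡ s))))

  pointCount≡⇒groupIso : ∀ (E₁ E₂ : Curve F) → Curve.B E₁ ≡ 0# → Curve.B E₂ ≡ 0# → Supersingular F p E₁ →
    pointCount F E₁ ≡ pointCount F E₂ → GroupIso F E₁ E₂
  pointCount≡⇒groupIso E₁ E₂ B₁≡0 B₂≡0 ss e = by-ratio (square? t)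
    where
    a₁ = Curve.A E₁
    a₂ = Curve.A E₂
    a₁≢0 : ¬ (a₁ ≡ 0#)
    a₁≢0 = B≡0⇒A≢0 E₁ B₁≡0
    t : Carrier
    t = a₂ * a₁ ⁻¹
    a₂≡ta₁ : a₂ ≡ t * a₁
    a₂≡ta₁ = sym (trans (*-assoc a₂ (a₁ ⁻¹) a₁)
      (trans (cong (a₂ *_) (trans (*-comm _ _) (*-inverse a₁ a₁≢0))) (*-identityʳ a₂)))
    count≡ : affineCount a₁ ≡ affineCount (t * a₁)
    count≡ = trans (pointCount≡⇒affineCount≡ E₁ E₂ B₁≡0 B₂≡0 e) (cong affineCount a₂≡ta₁)

    by-root : ∀ d → d * d ≡ t → Dec (Square d) → GroupIso F E₁ E₂
    by-root d d²≡t (yes (u , u²≡d)) = scaling-iso B₁≡0 B₂≡0 u≢0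
      (trans a₂≡ta₁ (cong (_* a₁) (trans (sym d²≡t) (cong (λ z → z * z) (sym u²≡d)))))
      where
      u≢0 : ¬ (u ≡ 0#)
      u≢0 u≡0 = B≡0⇒A≢0 E₂ B₂≡0 (trans a₂≡ta₁ (trans (cong (_* a₁) t≡0) (zeroˡ a₁)))
        where
        t≡0 : t ≡ 0#
        t≡0 = trans (sym d²≡t) (trans (cong (_* d) (trans (sym u²≡d) (trans (cong (_* u) u≡0) (zeroˡ u)))) (zeroˡ d))
    by-root d d²≡t (no ¬sq-d) with prime-mod4 p-prime 3<p
    -- `Supersingular` speaks of the point count minus one, which is the affine count that
    -- `ordinary` shows to be prime to p.
    ... | inj₁ (h , p≡) = contradiction (subst (p ∣_) (cong ℕ.pred (pointCount≡ E₁ B₁≡0)) ss) (ordinary {h} p≡ a₁≢0)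
    ... | inj₂ (h , p≡) =
      let u , u≢0 , e′ = twist-fourth-power {h} p≡ ¬sq-a₁ ¬sq-d
      in frobenius-iso B₁≡0 B₂≡0 u≢0 (trans a₂≡ta₁ (trans (cong (_* a₁) (sym d²≡t)) e′))
      where
      ¬sq-a₁ : ¬ Square a₁
      ¬sq-a₁ = quadratic-twist-nonsquare a₁≢0 ¬sq-d (trans count≡ (cong (λ z → affineCount (z * a₁)) (sym d²≡t)))

    by-ratio : Dec (Square t) → GroupIso F E₁ E₂
    by-ratio (no ¬sq-t)       = contradiction count≡ (nonsquare-ratio a₁≢0 ¬sq-t)
    by-ratio (yes (d , d²≡t)) = by-root d d²≡t (square? d)

theorem5p5 : (p r : ℕ) → Prime p → 3 < p → 2 ∣ r →
    (F : FiniteField (p ^ r)) → (E₁ E₂ : Curve F) →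
    Supersingular F p E₁ → Supersingular F p E₂ →
    jInvariant F E₁ ≡ FiniteField.fromℕ F 1728 →
    jInvariant F E₂ ≡ FiniteField.fromℕ F 1728 →
    (pointCount F E₁ ≡ pointCount F E₂) ⇔ GroupIso F E₁ E₂
theorem5p5 (suc p′) r p-prime 3<p 2∣r F E₁ E₂ ss₁ ss₂ j₁ j₂ = mk⇔
  (J.pointCount≡⇒groupIso E₁ E₂ (J.j≡1728⇒B≡0 E₁ j₁) (J.j≡1728⇒B≡0 E₂ j₂) ss₁)
  (IsomorphismTheory.groupIso⇒pointCount≡ F {E₁} {E₂})
  where
  n-order = even-power p-prime 3<p 2∣r
  module J = J1728Theory r (proj₁ n-order) p-prime 3<p F (proj₂ n-order)
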